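{- Let $\mathcal P$ be a finite set of points in the Euclidean plane, let $T_{start}$ and $T_{end}$ be two triangulations of $\mathcal P$, let $F$ be a shortest valid sequence of flips transforming $T_{start}$ into $T_{end}$, and let $D_F$ be the directed acyclic graph of $F$. Then there exists a sequence of actions of length at most $2|V(D_F)|$, starting from a necessary edge in $T_{start}$, following which one performs a sequence of flips $F'$ of length $|V(D_F)|$ such that $F'$ is a topological sorting of $D_F$.
   Context: Triangulations and flips. A triangulation of $\mathcal P$ is a maximal planar (straight-line) subdivision with vertex set $\mathcal P$. If an edge $e$ of a triangulation $T$ is a diagonal of a convex quadrilateral formed by the two triangles of $T$ containing $e$, a flip $f$ of $e$ deletes $e$ and inserts the other diagonal $e'$ of that quadrilateral; otherwise flipping $e$ is not allowed. Write $\varepsilon(f)=e$ (underlying edge) and $\varphi(f)=e'$ (resulting edge). A sequence of flips $F=\langle f_1,\dots,f_r\rangle$ is valid (transforms $T_{start}$ into $T_{end}$) if there are triangulations $T_0=T_{start},T_1,\dots,T_r=T_{end}$ such that performing $f_i$ on $T_{i-1}$ gives $T_i$ for $i=1,\dots,r$. A shortest valid sequence is one of minimum length among all valid sequences. The graph $D_F$. For $1\le i<j\le r$, flip $f_j$ is adjacent to $f_i$, written $f_i\to f_j$, if (1) either $\varphi(f_i)=\varepsilon(f_j)$, or $\varphi(f_i)$ and $\varepsilon(f_j)$ share a triangle in $T_{j-1}$; and (2) there is no $p$ with $i<p<j$ and $\varphi(f_i)=\varepsilon(f_p)$. $D_F$ is the directed acyclic graph whose nodes are the flips of $F$ and which has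 an arc from $f_i$ to $f_j$ exactly when $f_i\to f_j$. Nodes of $D_F$ are identified with flips. Necessary edges. An edge of the current triangulation that does not belong to $T_{end}$ is called a necessary edge. Actions. At any time there are a current triangulation $T_{current}$ (initially $T_{start}$), a current walk $W$ (a sequence of edges of $T_{current}$), and a current edge, which is the last edge of $W$. There are two types of actions: (i) move: move from the current edge $e_1$ to an edge $e_2$ that shares a triangle with $e_1$ in $T_{current}$ ($e_2$ is appended to $W$ and becomes the current edge); (ii) flip and back: flip the current edge in $T_{current}$, remove it from $W$, and move back to the previous edge in $W$ (if there is one), which becomes the current edge. The process consists of iterations: while $T_{current}\ne T_{end}$, an iteration begins by choosing a necessary edge of $T_{current}$ as the single edge of $W$ (this choice does not count as an action), and it ends when an action of type (ii) has flipped this initial edge so that $W$ is empty. If $T_{start}=T_{end}$ the sequence of actions is empty. The length of a sequence of actions is the total number of actions of types (i) and (ii) over all iterations, and $F'$ is the sequence of flips performed by the actions of type (ii), in order. -}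

module Defs where

open import Level using (Level; _⊔_) renaming (suc to lsuc)
open import Algebra.Core using (Op₁; Op₂)
open import Algebra.Bundles using (CommutativeRing)
open import Algebra.Structures using (IsCommutativeRing)
open import Data.Bool.Base using (Bool; true)
open import Data.Fin.Base using (Fin; zero; suc; inject₁; fromℕ) renaming (_<_ to _<ᶠ_)
open import Data.List.Base using (List; []; _∷_; length; lookup)
open import Data.List.Relation.Unary.All using (All)
open import Data.Nat.Base as ℕ using (ℕ)
open import Data.Product.Base using (∃-syntax; _×_; _,_)
open import Data.Sum.Base using (_⊎_)
open import Data.Vec.Functional using (Vector)
open import Function.Bundles using (_⇔_; _↔_; Inverse)
open import Relation.Binary.Core using (Rel)
open import Relation.Binary.PropositionalEquality.Core using (_≡_; _≢_)
open import Relation.Binary.Structures using (IsStrictTotalOrder)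
open import Relation.Nullary.Negation.Core using (¬_)

import Algebra.Definitions.RawMonoid as RawMonoidDefinitions
import Relation.Binary.Construct.StrictToNonStrict as StrictToNonStrict

-- The real numbers, axiomatised as an Archimedean, Cauchy complete, totally
-- ordered field.  Classically this determines ℝ up to unique isomorphism; the
-- trichotomy in isStrictTotalOrder is the classical order of ℝ.
record RealNumbers (c ℓ₁ ℓ₂ : Level) : Set (lsuc (c ⊔ ℓ₁ ⊔ ℓ₂)) where
  infix  8 -_
  infixl 7 _*_
  infixl 6 _+_ _-_
  infix  4 _≈_ _<_
  field
    Carrier            : Set c
    _≈_                : Rel Carrier ℓ₁
    _<_                : Rel Carrier ℓ₂
    _+_ _*_            : Op₂ Carrier
    -_                 : Op₁ Carrier
    0# 1#              : Carrier
    isCommutativeRing  : IsCommutativeRing _≈_ _+_ _*_ -_ 0# 1#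
    isStrictTotalOrder : IsStrictTotalOrder _≈_ _<_
    0<1                : 0# < 1#
    +-monoˡ-<          : ∀ z {x y} → x < y → x + z < y + z
    *-pos              : ∀ {x y} → 0# < x → 0# < y → 0# < x * y
    inverse            : ∀ x → ¬ (x ≈ 0#) → ∃[ y ] x * y ≈ 1#

  commutativeRing : CommutativeRing c ℓ₁
  commutativeRing = record { isCommutativeRing = isCommutativeRing }

  open StrictToNonStrict _≈_ _<_ public using (_≤_)
  open RawMonoidDefinitions (CommutativeRing.+-rawMonoid commutativeRing)
    renaming (_×_ to _·_)

  _-_ : Op₂ Carrier
  x - y = x + (- y)

  -- Bounding s m - s n for all large m and n bounds its absolute value.
  IsCauchy : (ℕ → Carrier) → Set (c ⊔ ℓ₂)
  IsCauchy s = ∀ ε → 0# < ε →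
    ∃[ N ] ∀ m n → N ℕ.≤ m → N ℕ.≤ n → s m - s n < ε

  _ConvergesTo_ : (ℕ → Carrier) → Carrier → Set (c ⊔ ℓ₂)
  s ConvergesTo l = ∀ ε → 0# < ε →
    ∃[ N ] ∀ n → N ℕ.≤ n → (s n - l < ε) × (l - s n < ε)

  field
    archimedean : ∀ x → ∃[ n ] x < n · 1#
    complete    : ∀ s → IsCauchy s → ∃[ l ] s ConvergesTo l

record Digraph (ℓ : Level) : Set (lsuc ℓ) where
  field
    ∣V∣ : ℕ
    Arc : Rel (Fin ∣V∣) ℓ

open Digraph public

-- The list xs arranges the nodes of G, where node i is labelled by label i, so
-- that all arcs point forward.
record IsTopologicalSorting {ℓ} {A : Set} (G : Digraph ℓ)
                            (label : Fin (∣V∣ G) → A) (xs : List A) : Set ℓ where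
  field
    position : Fin (∣V∣ G) ↔ Fin (length xs)
    labelled : ∀ i → lookup xs (Inverse.to position i) ≡ label i
    forward  : ∀ {i j} → Arc G i j → Inverse.to position i <ᶠ Inverse.to position j

-- Unordered pairs of distinct indices, represented by their increasing order.
-- The irrelevant proof makes _≡_ the equality of unordered pairs.
record Edge (n : ℕ) : Set where
  constructor edge
  field
    lo hi  : Fin n
    .lo<hi : lo <ᶠ hi

module Plane {c ℓ₁ ℓ₂} (ℝ : RealNumbers c ℓ₁ ℓ₂) where
  open RealNumbers ℝ

  Point : Set c
  Point = Carrier × Carrier

  infix 4 _≈ₚ_
  _≈ₚ_ : Rel Point ℓ₁
  (x₁ , y₁) ≈ₚ (x₂ , y₂) = (x₁ ≈ x₂) × (y₁ ≈ y₂)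

  infixl 6 _+ₚ_
  _+ₚ_ : Op₂ Point
  (x₁ , y₁) +ₚ (x₂ , y₂) = (x₁ + x₂ , y₁ + y₂)

  infixr 7 _*ₚ_
  _*ₚ_ : Carrier → Point → Point
  t *ₚ (x , y) = (t * x , t * y)

  -- Positive iff a, b, c make a left turn, zero iff they are collinear.
  orient : Point → Point → Point → Carrier
  orient (ax , ay) (bx , by) (cx , cy) =
    (bx - ax) * (cy - ay) - (by - ay) * (cx - ax)

  InSegment : Point → Point → Point → Set (c ⊔ ℓ₁ ⊔ ℓ₂)
  InSegment a b x =
    ∃[ s ] ∃[ t ] (0# ≤ s) × (0# ≤ t) × (s + t ≈ 1#) × (x ≈ₚ s *ₚ a +ₚ t *ₚ b)

  InOpenTriangle : Point → Point → Point → Point → Set (c ⊔ ℓ₁ ⊔ ℓ₂)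
  InOpenTriangle a b d x =
    ∃[ s ] ∃[ t ] ∃[ u ] (0# < s) × (0# < t) × (0# < u) × (s + t + u ≈ 1#) ×
                         (x ≈ₚ s *ₚ a +ₚ t *ₚ b +ₚ u *ₚ d)

  -- The vertices are listed counterclockwise and all interior angles are less
  -- than π.
  ConvexQuadrilateral : Point → Point → Point → Point → Set ℓ₂
  ConvexQuadrilateral p q r s =
    (0# < orient p q r) × (0# < orient q r s) × (0# < orient r s p) × (0# < orient s p q)

  record PointSet (n : ℕ) : Set (c ⊔ ℓ₁) where
    field
      point    : Fin n → Point
      distinct : ∀ {i j} → point i ≈ₚ point j → i ≡ j

module Triangulations {c ℓ₁ ℓ₂} (ℝ : RealNumbers c ℓ₁ ℓ₂)
                      {n : ℕ} (P : Plane.PointSet ℝ n) where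
  open RealNumbers ℝ using (_≈_; 0#)
  open Plane ℝ
  open PointSet P public
  open Edge

  private
    ℓ : Level
    ℓ = c ⊔ ℓ₁ ⊔ ℓ₂

  _EndpointOf_ : Fin n → Edge n → Set
  v EndpointOf e = (v ≡ lo e) ⊎ (v ≡ hi e)

  Joins : Edge n → Fin n → Fin n → Set
  Joins e a b = (lo e ≡ a × hi e ≡ b) ⊎ (lo e ≡ b × hi e ≡ a)

  _On_ : Point → Edge n → Set ℓ
  x On e = InSegment (point (lo e)) (point (hi e)) x

  EdgeSet : Set
  EdgeSet = Edge n → Bool

  infix 4 _∈_ _∉_ _⊆_
  _∈_ _∉_ : Edge n → EdgeSet → Set
  e ∈ S = S e ≡ true
  e ∉ S = ¬ (e ∈ S)

  _⊆_ : Rel EdgeSet _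
  S ⊆ S′ = ∀ e → e ∈ S → e ∈ S′

  record Planar (S : EdgeSet) : Set ℓ where
    field
      noVertexInside : ∀ {e} → e ∈ S → ∀ v → point v On e → v EndpointOf e
      noCrossing     : ∀ {e e′} → e ∈ S → e′ ∈ S → e ≢ e′ → ∀ x → x On e → x On e′ →
                       ∃[ v ] v EndpointOf e × v EndpointOf e′ × x ≈ₚ point v

  record Triangulation : Set ℓ where
    field
      edges   : EdgeSet
      planar  : Planar edges
      maximal : ∀ S → Planar S → edges ⊆ S → S ⊆ edges

  open Triangulation public

  infix 4 _≐_
  _≐_ : Rel Triangulation _
  T ≐ T′ = ∀ e → edges T e ≡ edges T′ e

  -- a b d bound a face of the subdivision: no vertex and no point of an edge
  -- lies in the interior.
  record Triangle (T : Triangulation) (a b d : Fin n) : Set ℓ where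
    field
      nondegenerate : ¬ (orient (point a) (point b) (point d) ≈ 0#)
      side₁         : ∃[ e ] Joins e a b × e ∈ edges T
      side₂         : ∃[ e ] Joins e b d × e ∈ edges T
      side₃         : ∃[ e ] Joins e d a × e ∈ edges T
      noVertex      : ∀ v → ¬ InOpenTriangle (point a) (point b) (point d) (point v)
      noEdge        : ∀ {e} → e ∈ edges T → ∀ x → x On e →
                      ¬ InOpenTriangle (point a) (point b) (point d) x

  SideOf : Edge n → Fin n → Fin n → Fin n → Set
  SideOf e a b d = Joins e a b ⊎ Joins e b d ⊎ Joins e d a

  ShareTriangle : Triangulation → Edge n → Edge n → Set ℓ
  ShareTriangle T e e′ =
    (e ≢ e′) ×
    ∃[ a ] ∃[ b ] ∃[ d ] Triangle T a b d × SideOf e a b d × SideOf e′ a b d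

  -- ε is the underlying edge and φ the resulting edge.
  record Flip : Set where
    constructor flip
    field
      ε φ : Edge n

  open Flip public

  -- The quadrilateral is p q r s, formed by the triangles p q r and r s p on
  -- both sides of ε f = pr; the other diagonal is φ f = qs.
  record Performs (f : Flip) (T T′ : Triangulation) : Set ℓ where
    field
      present    : ε f ∈ edges T
      p q r s    : Fin n
      underlying : Joins (ε f) p r
      resulting  : Joins (φ f) q s
      triangle₁  : Triangle T p q r
      triangle₂  : Triangle T r s p
      convex     : ConvexQuadrilateral (point p) (point q) (point r) (point s)
      result     : ∀ e → e ∈ edges T′ ⇔ ((e ∈ edges T × e ≢ ε f) ⊎ e ≡ φ f)

  -- Flips are indexed from 0, so flip i is performed on stage (inject₁ i).
  record Valid {r : ℕ} (F : Vector Flip r) (Tstart Tend : Triangulation) : Set ℓ where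
    field
      stage    : Fin (ℕ.suc r) → Triangulation
      starts   : stage zero ≐ Tstart
      ends     : stage (fromℕ r) ≐ Tend
      performs : ∀ i → Performs (F i) (stage (inject₁ i)) (stage (suc i))

  IsShortest : {r : ℕ} → Vector Flip r → Triangulation → Triangulation → Set ℓ
  IsShortest {r} F Tstart Tend =
    Valid F Tstart Tend × (∀ {k} (G : Vector Flip k) → Valid G Tstart Tend → r ℕ.≤ k)

  D : ∀ {r} (F : Vector Flip r) {Tstart Tend} → Valid F Tstart Tend → Digraph ℓ
  D {r} F valid = record
    { ∣V∣ = r
    ; Arc = λ i j →
        (i <ᶠ j) ×
        ((φ (F i) ≡ ε (F j)) ⊎ ShareTriangle (stage (inject₁ j)) (φ (F i)) (ε (F j))) ×
        ¬ (∃[ p ] (i <ᶠ p) × (p <ᶠ j) × (φ (F i) ≡ ε (F p)))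
    }
    where open Valid valid

  Necessary : Triangulation → Triangulation → Edge n → Set
  Necessary Tend T e = (e ∈ edges T) × (e ∉ edges Tend)

  data Action : Set where
    move        : Edge n → Action
    flipAndBack : Action

  -- Run Tend T W as F′: with current triangulation T and current walk W, the
  -- actions as can be carried out until the process terminates, and perform the
  -- flips F′.  Walks are listed from their last edge, so that the head of W is
  -- the current edge.
  data Run (Tend : Triangulation) :
           Triangulation → List (Edge n) → List Action → List Flip → Set ℓ where

    finish : ∀ {T} → T ≐ Tend → Run Tend T [] [] []

    -- A new iteration begins; choosing its initial edge is not an action.
    begin  : ∀ {T e as F′} → ¬ (T ≐ Tend) → Necessary Tend T e →
             Run Tend T (e ∷ []) as F′ →
             Run Tend T [] as F′

    moving : ∀ {T e e′ W as F′} → ShareTriangle T e e′ →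
             Run Tend T (e′ ∷ e ∷ W) as F′ →
             Run Tend T (e ∷ W) (move e′ ∷ as) F′

    -- The edges that remain on the walk must be edges of the new triangulation.
    flipping : ∀ {T T′ f W as F′} → Performs f T T′ → All (_∈ edges T′) W →
               Run Tend T′ W as F′ →
               Run Tend T (ε f ∷ W) (flipAndBack ∷ as) (f ∷ F′)

{-# OPTIONS --safe #-}

-- While edges of the triangulation are still to be replaced, walk from a necessary
-- edge e as follows.  If no flip before the first flip f of e in the remaining
-- sequence changes a triangle at e, the quadrilateral of f is already present and f
-- commutes with all flips before it: perform f and step back.  Otherwise the first
-- such flip removes an edge that shares a triangle with e in the current
-- triangulation: move there.  Every edge put on the walk is flipped exactly once,
-- whence at most two actions per flip, and a flip overtakes only flips on which it
-- does not depend.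
--
-- Flips can be exchanged because everything about a flip but the presence of five
-- edges is independent of the triangulation: in a planar subdivision, a
-- counterclockwise triangle of edges without vertices in its interior is a face, and
-- an edge has at most one face on each side.

module Submission where

open import Defs
open import Level using (_⊔_)
open import Algebra.Bundles using (CommutativeRing)
import Algebra.Properties.AbelianGroup as AbelianGroupProperties
import Algebra.Properties.Ring as RingProperties
import Algebra.Properties.Semiring.Mult as SemiringMult
import Algebra.Solver.Ring as RingSolver
open import Algebra.Solver.Ring.AlmostCommutativeRing
  using (fromCommutativeRing; _-Raw-AlmostCommutative⟶_)
open import Data.Bool.Base using (true; false)
import Data.Bool.Properties as Bool
import Data.Empty.Irrelevant as Irrelevant
open import Data.Fin.Base as Fin using (Fin; zero; suc; inject₁; fromℕ)
import Data.Fin.Properties as Fin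
open import Data.Integer.Base as ℤ using (ℤ; +_; -[1+_]; _⊖_)
import Data.Integer.Properties as ℤ
open import Data.List.Base using (List; []; _∷_; _++_; length; lookup; map; tabulate; allFin)
open import Data.List.Membership.Propositional using () renaming (_∈_ to _∈ˡ_)
open import Data.List.Membership.Propositional.Properties using (∈-allFin)
open import Data.List.Properties using (length-map; length-tabulate)
open import Data.List.Relation.Binary.Permutation.Propositional
  using (_↭_; prep; ↭-refl; ↭-trans; ↭-sym)
open import Data.List.Relation.Binary.Permutation.Propositional.Properties
  using (All-resp-↭; ∈-resp-↭; ↭-length; shift)
open import Data.List.Relation.Unary.All as All using (All; []; _∷_)
import Data.List.Relation.Unary.All.Properties as All
open import Data.List.Relation.Unary.AllPairs using (AllPairs; []; _∷_)
import Data.List.Relation.Unary.AllPairs.Properties as AllPairs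
open import Data.List.Relation.Unary.Any using (here; there)
open import Data.Maybe.Base using (Maybe; just; nothing)
open import Data.Nat.Base as ℕ using (ℕ; zero; suc; z≤n; s≤s)
import Data.Nat.Properties as ℕ
open import Data.Product.Base using (_×_; _,_; proj₁; proj₂; ∃-syntax)
open import Data.Sum.Base as Sum using (_⊎_; inj₁; inj₂; swap)
open import Data.Vec.Functional as Vector using (Vector)
open import Function.Base using (_∘_)
open import Function.Bundles using (_⇔_; mk⇔; mk↔ₛ′; Equivalence)
open import Relation.Binary.Definitions using (tri<; tri≈; tri>)
open import Relation.Binary.PropositionalEquality
  using (_≡_; _≢_; refl; sym; trans; cong; subst; subst₂; ≢-sym)
import Relation.Binary.Reasoning.Setoid as SetoidReasoning
open import Relation.Binary.Structures using (IsStrictTotalOrder)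
open import Relation.Nullary using (¬_; Dec; yes; no; contradiction)
open import Relation.Nullary.Decidable using (_⊎-dec_; _×-dec_; ¬?; map′)

-- The arcs of `D F valid` refer to the stages of the original sequence, whereas the run passes
-- through other triangulations. An arc into flip j is therefore weakened to a statement about edges
-- only: the edge inserted by i is the diagonal removed by j or a side of its quadrilateral
-- (`InQuad`). No stage occurs in it any more, so a flip violates no arc if it overtakes only flips
-- whose inserted edges avoid its quadrilateral. Minimality of F keeps the process from terminating
-- early: if `Tend` were reached after k flips, these would form a valid sequence, whence r ≤ k.
-- While flips remain, the triangulation thus differs from `Tend`, and by maximality it contains a
-- necessary edge at which a new iteration can begin.

-- Ring identities with integer coefficients

module IntegerSolver {c ℓ} (R : CommutativeRing c ℓ) where
  open CommutativeRing R
    renaming (_+_ to _⊕_; _*_ to _⊛_; refl to ≈-refl; sym to ≈-sym; trans to ≈-trans)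
  open AbelianGroupProperties +-abelianGroup using (⁻¹-∙-comm; ε⁻¹≈ε; ⁻¹-involutive)
  open RingProperties ring using (-‿distribˡ-*)
  open SemiringMult semiring using (×-homo-+) renaming (_×_ to _·_)
  open SetoidReasoning setoid

  ⟦_⟧ : ℤ → Carrier
  ⟦ + n ⟧      = n · 1#
  ⟦ -[1+ n ] ⟧ = - (suc n · 1#)

  ⊖-homo : ∀ m n → ⟦ m ⊖ n ⟧ ≈ (m · 1#) ⊕ - (n · 1#)
  ⊖-homo zero    zero    = ≈-sym (≈-trans (+-identityˡ _) ε⁻¹≈ε)
  ⊖-homo zero    (suc n) = ≈-sym (+-identityˡ _)
  ⊖-homo (suc m) zero    = ≈-sym (≈-trans (+-congˡ ε⁻¹≈ε) (+-identityʳ _))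
  ⊖-homo (suc m) (suc n) = begin
    ⟦ suc m ⊖ suc n ⟧                        ≡⟨ cong ⟦_⟧ (ℤ.[1+m]⊖[1+n]≡m⊖n m n) ⟩
    ⟦ m ⊖ n ⟧                                ≈⟨ ⊖-homo m n ⟩
    M ⊕ - N                                  ≈⟨ +-congʳ (+-identityˡ M) ⟨
    (0# ⊕ M) ⊕ - N                           ≈⟨ +-congʳ (+-congʳ (-‿inverseʳ 1#)) ⟨
    ((1# ⊕ - 1#) ⊕ M) ⊕ - N                  ≈⟨ +-congʳ (+-assoc 1# (- 1#) M) ⟩
    (1# ⊕ (- 1# ⊕ M)) ⊕ - N                  ≈⟨ +-congʳ (+-congˡ (+-comm (- 1#) M)) ⟩
    (1# ⊕ (M ⊕ - 1#)) ⊕ - N                  ≈⟨ +-congʳ (+-assoc 1# M (- 1#)) ⟨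
    ((1# ⊕ M) ⊕ - 1#) ⊕ - N                  ≈⟨ +-assoc (1# ⊕ M) (- 1#) (- N) ⟩
    (1# ⊕ M) ⊕ (- 1# ⊕ - N)                  ≈⟨ +-congˡ (⁻¹-∙-comm 1# N) ⟩
    (1# ⊕ M) ⊕ - (1# ⊕ N)                    ∎
    where
    M = m · 1#
    N = n · 1#

  +-homo : ∀ i j → ⟦ i ℤ.+ j ⟧ ≈ ⟦ i ⟧ ⊕ ⟦ j ⟧
  +-homo (+ m)    (+ n)    = ×-homo-+ 1# m n
  +-homo (+ m)    -[1+ n ] = ⊖-homo m (suc n)
  +-homo -[1+ m ] (+ n)    = ≈-trans (⊖-homo n (suc m)) (+-comm _ _)
  +-homo -[1+ m ] -[1+ n ] = begin
    - (suc (suc (m ℕ.+ n)) · 1#)            ≡⟨ cong (λ k → - (suc k · 1#)) (ℕ.+-suc m n) ⟨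
    - ((suc m ℕ.+ suc n) · 1#)              ≈⟨ -‿cong (×-homo-+ 1# (suc m) (suc n)) ⟩
    - ((suc m · 1#) ⊕ (suc n · 1#))         ≈⟨ ⁻¹-∙-comm _ _ ⟨
    - (suc m · 1#) ⊕ - (suc n · 1#)         ∎

  -‿homo : ∀ i → ⟦ ℤ.- i ⟧ ≈ - ⟦ i ⟧
  -‿homo (+ zero)  = ≈-sym ε⁻¹≈ε
  -‿homo (+ suc n) = ≈-refl
  -‿homo -[1+ n ]  = ≈-sym (⁻¹-involutive _)

  pos-*-homo : ∀ m j → ⟦ + m ℤ.* j ⟧ ≈ (m · 1#) ⊛ ⟦ j ⟧
  pos-*-homo zero    j = ≈-sym (zeroˡ _)
  pos-*-homo (suc m) j = begin
    ⟦ + suc m ℤ.* j ⟧                 ≡⟨ cong ⟦_⟧ (ℤ.suc-* (+ m) j) ⟩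
    ⟦ j ℤ.+ + m ℤ.* j ⟧               ≈⟨ +-homo j (+ m ℤ.* j) ⟩
    ⟦ j ⟧ ⊕ ⟦ + m ℤ.* j ⟧             ≈⟨ +-cong (≈-sym (*-identityˡ _)) (pos-*-homo m j) ⟩
    (1# ⊛ ⟦ j ⟧) ⊕ ((m · 1#) ⊛ ⟦ j ⟧) ≈⟨ distribʳ _ _ _ ⟨
    (1# ⊕ (m · 1#)) ⊛ ⟦ j ⟧           ∎

  *-homo : ∀ i j → ⟦ i ℤ.* j ⟧ ≈ ⟦ i ⟧ ⊛ ⟦ j ⟧
  *-homo (+ m)    j = pos-*-homo m j
  *-homo -[1+ m ] j = begin
    ⟦ -[1+ m ] ℤ.* j ⟧             ≡⟨ cong ⟦_⟧ (ℤ.neg-distribˡ-* (+ suc m) j) ⟨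
    ⟦ ℤ.- (+ suc m ℤ.* j) ⟧        ≈⟨ -‿homo (+ suc m ℤ.* j) ⟩
    - ⟦ + suc m ℤ.* j ⟧            ≈⟨ -‿cong (pos-*-homo (suc m) j) ⟩
    - ((suc m · 1#) ⊛ ⟦ j ⟧)       ≈⟨ -‿distribˡ-* _ _ ⟩
    - (suc m · 1#) ⊛ ⟦ j ⟧         ∎

  morphism : ℤ.+-*-rawRing -Raw-AlmostCommutative⟶ fromCommutativeRing R
  morphism = record
    { ⟦_⟧    = ⟦_⟧
    ; +-homo = +-homo
    ; *-homo = *-homo
    ; -‿homo = -‿homo
    ; 0-homo = ≈-refl
    ; 1-homo = +-identityʳ 1#
    }

  -- Equality of integer coefficients computes, so the normal forms of the solver can drop terms
  -- that cancel; abstract constants of the ring would block this.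
  coefficient≟ : ∀ i j → Maybe (⟦ i ⟧ ≈ ⟦ j ⟧)
  coefficient≟ i j with i ℤ.≟ j
  ... | yes refl = just ≈-refl
  ... | no  _    = nothing

  open RingSolver ℤ.+-*-rawRing (fromCommutativeRing R) morphism coefficient≟ public
    using (solve; _:=_; _:+_; _:*_; _:-_; :-_; con; Polynomial)

-- Signs, orientations, segments and triangles in the plane

module Geometry {c ℓ₁ ℓ₂} (ℝ : RealNumbers c ℓ₁ ℓ₂) where
  open RealNumbers ℝ hiding (commutativeRing)
  open CommutativeRing (RealNumbers.commutativeRing ℝ) public
    using (ring; +-identityˡ; +-identityʳ; +-comm; +-cong; +-congˡ; +-congʳ;
           *-identityˡ; *-congˡ; *-congʳ; zeroˡ; zeroʳ; -‿inverseʳ; -‿cong)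
    renaming (refl to ≈-refl; sym to ≈-sym; trans to ≈-trans; setoid to ≈-setoid)
  open RingProperties ring public using (-0#≈0#; -‿involutive)
  open IsStrictTotalOrder isStrictTotalOrder
    using (compare; <-respʳ-≈; <-respˡ-≈) renaming (irrefl to <-irrefl; trans to <-trans)
  open IntegerSolver (RealNumbers.commutativeRing ℝ)
  open Plane ℝ
  open SetoidReasoning ≈-setoid

  pos-resp : ∀ {x y} → x ≈ y → 0# < x → 0# < y
  pos-resp = <-respʳ-≈

  nonneg-resp : ∀ {x y} → x ≈ y → 0# ≤ x → 0# ≤ y
  nonneg-resp x≈y (inj₁ 0<x) = inj₁ (pos-resp x≈y 0<x)
  nonneg-resp x≈y (inj₂ 0≈x) = inj₂ (≈-trans 0≈x x≈y)

  ≈0⇒≥0 : ∀ {x} → x ≈ 0# → 0# ≤ x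
  ≈0⇒≥0 x≈0 = inj₂ (≈-sym x≈0)

  ≈0⇒-≥0 : ∀ {x} → x ≈ 0# → 0# ≤ - x
  ≈0⇒-≥0 x≈0 = ≈0⇒≥0 (≈-trans (-‿cong x≈0) -0#≈0#)

  +-pos-nonneg : ∀ {x y} → 0# < x → 0# ≤ y → 0# < x + y
  +-pos-nonneg {x} {y} 0<x (inj₁ 0<y) =
    <-trans 0<y (<-respˡ-≈ (+-identityˡ y) (+-monoˡ-< y 0<x))
  +-pos-nonneg {x} 0<x (inj₂ 0≈y) =
    pos-resp (≈-trans (≈-sym (+-identityʳ x)) (+-congˡ 0≈y)) 0<x

  +-nonneg-pos : ∀ {x y} → 0# ≤ x → 0# < y → 0# < x + y
  +-nonneg-pos 0≤x 0<y = pos-resp (+-comm _ _) (+-pos-nonneg 0<y 0≤x)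

  +-nonneg : ∀ {x y} → 0# ≤ x → 0# ≤ y → 0# ≤ x + y
  +-nonneg (inj₁ 0<x) 0≤y = inj₁ (+-pos-nonneg 0<x 0≤y)
  +-nonneg (inj₂ 0≈x) 0≤y =
    nonneg-resp (≈-trans (≈-sym (+-identityˡ _)) (+-congʳ 0≈x)) 0≤y

  *-nonneg : ∀ {x y} → 0# ≤ x → 0# ≤ y → 0# ≤ x * y
  *-nonneg (inj₁ 0<x) (inj₁ 0<y) = inj₁ (*-pos 0<x 0<y)
  *-nonneg (inj₁ 0<x) (inj₂ 0≈y) = inj₂ (≈-sym (≈-trans (*-congˡ (≈-sym 0≈y)) (zeroʳ _)))
  *-nonneg (inj₂ 0≈x) 0≤y        = inj₂ (≈-sym (≈-trans (*-congʳ (≈-sym 0≈x)) (zeroˡ _)))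

  data Sign (x : Carrier) : Set (ℓ₁ ⊔ ℓ₂) where
    neg  : 0# < - x → Sign x
    null : x ≈ 0#   → Sign x
    pos  : 0# < x   → Sign x

  sign : ∀ x → Sign x
  sign x with compare 0# x
  ... | tri< 0<x _ _ = pos 0<x
  ... | tri≈ _ 0≈x _ = null (≈-sym 0≈x)
  ... | tri> _ _ x<0 =
    neg (<-respˡ-≈ (-‿inverseʳ x) (<-respʳ-≈ (+-identityˡ (- x)) (+-monoˡ-< (- x) x<0)))

  pos-or-nonneg : ∀ x → (0# < x) ⊎ (0# ≤ - x)
  pos-or-nonneg x with sign x
  ... | neg 0<-x = inj₂ (inj₁ 0<-x)
  ... | null x≈0 = inj₂ (≈0⇒-≥0 x≈0)
  ... | pos 0<x  = inj₁ 0<x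

  pos⇒≉0 : ∀ {x} → 0# < x → ¬ (x ≈ 0#)
  pos⇒≉0 0<x x≈0 = <-irrefl (≈-sym x≈0) 0<x

  pos⇒-≱0 : ∀ {x} → 0# < x → ¬ (0# ≤ - x)
  pos⇒-≱0 0<x 0≤-x = pos⇒≉0 (+-pos-nonneg 0<x 0≤-x) (-‿inverseʳ _)

  pos-inverse : ∀ {x} → 0# < x → ∃[ y ] (x * y ≈ 1#) × (0# < y)
  pos-inverse {x} 0<x with inverse x (pos⇒≉0 0<x)
  ... | y , xy≈1 with sign y
  ...   | pos 0<y  = y , xy≈1 , 0<y
  ...   | null y≈0 =
    contradiction (≈-trans (≈-sym xy≈1) (≈-trans (*-congˡ y≈0) (zeroʳ x))) (pos⇒≉0 0<1)
  ...   | neg 0<-y = contradiction (inj₁ (pos-resp lemma (*-pos 0<x 0<-y))) (pos⇒-≱0 0<1)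
    where
    lemma : x * - y ≈ - 1#
    lemma = ≈-trans (solve 2 (λ a b → a :* :- b := :- (a :* b)) ≈-refl x y) (-‿cong xy≈1)

  ≈ₚ-refl : ∀ {x} → x ≈ₚ x
  ≈ₚ-refl = ≈-refl , ≈-refl

  orientᵖ : ∀ {k} (ax ay bx by cx cy : Polynomial k) → Polynomial k
  orientᵖ ax ay bx by cx cy = (bx :- ax) :* (cy :- ay) :- (by :- ay) :* (cx :- ax)

  orient-cong : ∀ a b {x y} → x ≈ₚ y → orient a b x ≈ orient a b y
  orient-cong a b (x₁≈ , x₂≈) =
    +-cong (*-congˡ (+-congʳ x₂≈)) (-‿cong (*-congˡ (+-congʳ x₁≈)))

  orient-rotate : ∀ a b d → orient b d a ≈ orient a b d
  orient-rotate (ax , ay) (bx , by) (dx , dy) =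
    solve 6 (λ ax ay bx by dx dy → orientᵖ bx by dx dy ax ay := orientᵖ ax ay bx by dx dy)
      ≈-refl ax ay bx by dx dy

  orient-swap : ∀ a b d → orient b a d ≈ - orient a b d
  orient-swap (ax , ay) (bx , by) (dx , dy) =
    solve 6 (λ ax ay bx by dx dy → orientᵖ bx by ax ay dx dy := :- orientᵖ ax ay bx by dx dy)
      ≈-refl ax ay bx by dx dy

  orient-aba : ∀ a b → orient a b a ≈ 0#
  orient-aba (ax , ay) (bx , by) =
    solve 4 (λ ax ay bx by → orientᵖ ax ay bx by ax ay := con (+ 0)) ≈-refl ax ay bx by

  orient-abb : ∀ a b → orient a b b ≈ 0#
  orient-abb (ax , ay) (bx , by) =
    solve 4 (λ ax ay bx by → orientᵖ ax ay bx by bx by := con (+ 0)) ≈-refl ax ay bx by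

  orient-aab : ∀ a b → orient a a b ≈ 0#
  orient-aab a b = ≈-trans (≈-sym (orient-rotate a a b)) (orient-aba a b)

  cancel : ∀ {σ} k → σ ≈ 1# → σ * k - k ≈ 0#
  cancel k σ≈1 = ≈-trans (+-congʳ (≈-trans (*-congʳ σ≈1) (*-identityˡ k))) (-‿inverseʳ k)

  -- `orient a b` is a linear form minus the constant `k`, the value of that form at `a`. For
  -- arbitrary weights the two sides therefore differ by `(s + t) * k - k`: this is a polynomial
  -- identity for the solver, and the correction vanishes by `cancel`.
  orient-affine : ∀ a b {u w z s t} → s + t ≈ 1# → z ≈ₚ s *ₚ u +ₚ t *ₚ w →
                  orient a b z ≈ s * orient a b u + t * orient a b w
  orient-affine a@(ax , ay) b@(bx , by) {u@(ux , uy)} {w@(wx , wy)} {z} {s} {t} s+t≈1 z≈ = begin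
    orient a b z                              ≈⟨ orient-cong a b z≈ ⟩
    orient a b (s *ₚ u +ₚ t *ₚ w)             ≈⟨ identity ⟩
    s * orient a b u + t * orient a b w + ((s + t) * k - k) ≈⟨ +-congˡ (cancel k s+t≈1) ⟩
    s * orient a b u + t * orient a b w + 0#  ≈⟨ +-identityʳ _ ⟩
    s * orient a b u + t * orient a b w       ∎
    where
    k = (bx - ax) * ay - (by - ay) * ax
    identity : orient a b (s *ₚ u +ₚ t *ₚ w) ≈
               s * orient a b u + t * orient a b w + ((s + t) * k - k)
    identity = solve 10 (λ ax ay bx by ux uy wx wy s t →
      let k = (bx :- ax) :* ay :- (by :- ay) :* ax in
      orientᵖ ax ay bx by (s :* ux :+ t :* wx) (s :* uy :+ t :* wy) :=
      s :* orientᵖ ax ay bx by ux uy :+ t :* orientᵖ ax ay bx by wx wy :+ ((s :+ t) :* k :- k))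
      ≈-refl ax ay bx by ux uy wx wy s t

  orient-cycle : ∀ a b d → orient d a b ≈ orient a b d
  orient-cycle a b d = ≈-sym (orient-rotate d a b)

  segment-sym : ∀ {a b x} → InSegment a b x → InSegment b a x
  segment-sym (s , t , 0≤s , 0≤t , s+t≈1 , x₁≈ , x₂≈) =
    t , s , 0≤t , 0≤s , ≈-trans (+-comm t s) s+t≈1 ,
    ≈-trans x₁≈ (+-comm _ _) , ≈-trans x₂≈ (+-comm _ _)

  segment-end : ∀ a b → InSegment a b b
  segment-end (ax , ay) (bx , by) =
    0# , 1# , inj₂ ≈-refl , inj₁ 0<1 , +-identityˡ 1# , end ax bx , end ay by
    where
    end : ∀ x y → y ≈ 0# * x + 1# * y
    end x y = ≈-sym (≈-trans (+-cong (zeroˡ x) (*-identityˡ y)) (+-identityˡ y))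

  segment-trans : ∀ {a b x y} → InSegment a b x → InSegment x b y → InSegment a b y
  segment-trans {a} {b} {x} {y} (s , t , 0≤s , 0≤t , s+t≈1 , x₁≈ , x₂≈)
                                (s′ , t′ , 0≤s′ , 0≤t′ , s′+t′≈1 , y₁≈ , y₂≈) =
    s′ * s , s′ * t + t′ , *-nonneg 0≤s′ 0≤s , +-nonneg (*-nonneg 0≤s′ 0≤t) 0≤t′ ,
    total , coordinate x₁≈ y₁≈ , coordinate x₂≈ y₂≈
    where
    total : s′ * s + (s′ * t + t′) ≈ 1#
    total = begin
      s′ * s + (s′ * t + t′) ≈⟨ solve 4 (λ s t s′ t′ →
        s′ :* s :+ (s′ :* t :+ t′) := (s :+ t) :* s′ :+ t′) ≈-refl s t s′ t′ ⟩
      (s + t) * s′ + t′      ≈⟨ +-congʳ (≈-trans (*-congʳ s+t≈1) (*-identityˡ s′)) ⟩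
      s′ + t′                ≈⟨ s′+t′≈1 ⟩
      1#                     ∎
    coordinate : ∀ {a b x y} → x ≈ s * a + t * b → y ≈ s′ * x + t′ * b →
                 y ≈ s′ * s * a + (s′ * t + t′) * b
    coordinate {a} {b} {x} {y} x≈ y≈ = begin
      y                               ≈⟨ y≈ ⟩
      s′ * x + t′ * b                 ≈⟨ +-congʳ (*-congˡ x≈) ⟩
      s′ * (s * a + t * b) + t′ * b   ≈⟨ solve 6 (λ s t s′ t′ a b →
        s′ :* (s :* a :+ t :* b) :+ t′ :* b := s′ :* s :* a :+ (s′ :* t :+ t′) :* b)
        ≈-refl s t s′ t′ a b ⟩
      s′ * s * a + (s′ * t + t′) * b  ∎

  segment-nonneg : ∀ a b {x y z} → InSegment x y z →
                   0# ≤ orient a b x → 0# ≤ orient a b y → 0# ≤ orient a b z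
  segment-nonneg a b (s , t , 0≤s , 0≤t , s+t≈1 , z≈) 0≤x 0≤y =
    nonneg-resp (≈-sym (orient-affine a b s+t≈1 z≈))
      (+-nonneg (*-nonneg 0≤s 0≤x) (*-nonneg 0≤t 0≤y))

  segment-pos : ∀ a b {x y z} → InSegment x y z →
                0# < orient a b x → 0# < orient a b y → 0# < orient a b z
  segment-pos a b {x} {y} {z} (s , t , 0≤s , 0≤t , s+t≈1 , z≈) 0<x 0<y =
    pos-resp (≈-sym (orient-affine a b s+t≈1 z≈)) (weighted 0≤s 0≤t)
    where
    weighted : 0# ≤ s → 0# ≤ t → 0# < s * orient a b x + t * orient a b y
    weighted (inj₁ 0<s) 0≤t = +-pos-nonneg (*-pos 0<s 0<x) (*-nonneg 0≤t (inj₁ 0<y))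
    weighted (inj₂ 0≈s) (inj₁ 0<t) =
      +-nonneg-pos (*-nonneg (inj₂ 0≈s) (inj₁ 0<x)) (*-pos 0<t 0<y)
    weighted (inj₂ 0≈s) (inj₂ 0≈t) = contradiction
      (≈-trans (≈-sym s+t≈1) (≈-trans (+-cong (≈-sym 0≈s) (≈-sym 0≈t)) (+-identityˡ 0#)))
      (pos⇒≉0 0<1)

  segment-null : ∀ a b {x y z} → InSegment x y z →
                 orient a b x ≈ 0# → orient a b y ≈ 0# → orient a b z ≈ 0#
  segment-null a b {x} {y} {z} (s , t , _ , _ , s+t≈1 , z≈) x≈0 y≈0 = begin
    orient a b z                         ≈⟨ orient-affine a b {x} {y} {z} s+t≈1 z≈ ⟩
    s * orient a b x + t * orient a b y
      ≈⟨ +-cong (≈-trans (*-congˡ x≈0) (zeroʳ s)) (≈-trans (*-congˡ y≈0) (zeroʳ t)) ⟩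
    0# + 0#                              ≈⟨ +-identityˡ 0# ⟩
    0#                                   ∎

  segment⇒collinear : ∀ a b {x} → InSegment a b x → orient a b x ≈ 0#
  segment⇒collinear a b {x} x∈ab =
    segment-null a b {a} {b} {x} x∈ab (orient-aba a b) (orient-abb a b)

  segment-zero : ∀ a b {x y z} → InSegment x y z →
                 0# < orient a b x → orient a b z ≈ 0# → ¬ (0# < orient a b y)
  segment-zero a b z∈xy 0<x z≈0 0<y = pos⇒≉0 (segment-pos a b z∈xy 0<x 0<y) z≈0

  segment-cross : ∀ a b {x y} → 0# < orient a b x → 0# < - orient a b y →
                  ∃[ z ] InSegment x y z × orient a b z ≈ 0#
  segment-cross a b {x} {y} 0<f 0<-g = _ , z∈xy , z≈0
    where
    f = orient a b x
    g = orient a b y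
    0<f-g : 0# < f + - g
    0<f-g = +-pos-nonneg 0<f (inj₁ 0<-g)
    i = proj₁ (pos-inverse 0<f-g)
    s t : Carrier
    -- The weights solve `s * f + t * g ≈ 0#` with sum one; `i` is the inverse of `f + - g`.
    s = - g * i
    t = f * i
    0<i = proj₂ (proj₂ (pos-inverse 0<f-g))
    s+t≈1 : s + t ≈ 1#
    s+t≈1 = ≈-trans
      (solve 3 (λ f g i → :- g :* i :+ f :* i := (f :- g) :* i) ≈-refl f g i)
      (proj₁ (proj₂ (pos-inverse 0<f-g)))
    z∈xy : InSegment x y (s *ₚ x +ₚ t *ₚ y)
    z∈xy = s , t , inj₁ (*-pos 0<-g 0<i) , inj₁ (*-pos 0<f 0<i) , s+t≈1 , ≈ₚ-refl
    z≈0 : orient a b (s *ₚ x +ₚ t *ₚ y) ≈ 0#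
    z≈0 = ≈-trans (orient-affine a b s+t≈1 ≈ₚ-refl)
      (solve 3 (λ f g i → :- g :* i :* f :+ f :* i :* g := con (+ 0)) ≈-refl f g i)

  -- Half-plane description of the interior of a counterclockwise triangle; `Barycentric` passes
  -- from it to the convex combinations of `InOpenTriangle`.
  Inside : Point → Point → Point → Point → Set ℓ₂
  Inside a b d x = (0# < orient a b x) × (0# < orient b d x) × (0# < orient d a x)

  Within : Point → Point → Point → Point → Set (ℓ₁ ⊔ ℓ₂)
  Within a b d x = (0# ≤ orient a b x) × (0# ≤ orient b d x) × (0# ≤ orient d a x)

  orient-sum : ∀ a b d x → orient b d x + orient d a x + orient a b x ≈ orient a b d
  orient-sum (ax , ay) (bx , by) (dx , dy) (x , y) =
    solve 8 (λ ax ay bx by dx dy x y →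
      orientᵖ bx by dx dy x y :+ orientᵖ dx dy ax ay x y :+ orientᵖ ax ay bx by x y
      := orientᵖ ax ay bx by dx dy) ≈-refl ax ay bx by dx dy x y

  -- The signed areas cut off by `x` are its barycentric coordinates scaled by `orient a b d`;
  -- together with `orient-sum`, division by that area gives weights of sum one.
  cramer : ∀ a b d x →
           orient a b d *ₚ x ≈ₚ orient b d x *ₚ a +ₚ orient d a x *ₚ b +ₚ orient a b x *ₚ d
  cramer (ax , ay) (bx , by) (dx , dy) (x , y) =
    solve 8 (λ ax ay bx by dx dy x y →
      orientᵖ ax ay bx by dx dy :* x :=
      orientᵖ bx by dx dy x y :* ax :+ orientᵖ dx dy ax ay x y :* bx :+
      orientᵖ ax ay bx by x y :* dx) ≈-refl ax ay bx by dx dy x y ,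
    solve 8 (λ ax ay bx by dx dy x y →
      orientᵖ ax ay bx by dx dy :* y :=
      orientᵖ bx by dx dy x y :* ay :+ orientᵖ dx dy ax ay x y :* by :+
      orientᵖ ax ay bx by x y :* dy) ≈-refl ax ay bx by dx dy x y

  module Barycentric {a b d : Point} (0<O : 0# < orient a b d) (x : Point) where
    private
      i : Carrier
      i = proj₁ (pos-inverse 0<O)
      0<i : 0# < i
      0<i = proj₂ (proj₂ (pos-inverse 0<O))
      Oi≈1 : orient a b d * i ≈ 1#
      Oi≈1 = proj₁ (proj₂ (pos-inverse 0<O))
      A B C : Carrier
      A = orient b d x
      B = orient d a x
      C = orient a b x

    s t u : Carrier
    s = A * i
    t = B * i
    u = C * i

    total : s + t + u ≈ 1#
    total = begin
      A * i + B * i + C * i ≈⟨ solve 4 (λ A B C i →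
        A :* i :+ B :* i :+ C :* i := (A :+ B :+ C) :* i) ≈-refl A B C i ⟩
      (A + B + C) * i       ≈⟨ *-congʳ (orient-sum a b d x) ⟩
      orient a b d * i      ≈⟨ Oi≈1 ⟩
      1#                    ∎

    private
      divide : ∀ {z α β δ} → orient a b d * z ≈ A * α + B * β + C * δ →
               z ≈ s * α + t * β + u * δ
      divide {z} {α} {β} {δ} eq = begin
        z                                 ≈⟨ *-identityˡ z ⟨
        1# * z                            ≈⟨ *-congʳ Oi≈1 ⟨
        orient a b d * i * z              ≈⟨ solve 3 (λ O i z → O :* i :* z := i :* (O :* z))
                                               ≈-refl (orient a b d) i z ⟩
        i * (orient a b d * z)            ≈⟨ *-congˡ eq ⟩
        i * (A * α + B * β + C * δ)       ≈⟨ solve 7 (λ A B C i α β δ →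
          i :* (A :* α :+ B :* β :+ C :* δ) := A :* i :* α :+ B :* i :* β :+ C :* i :* δ)
          ≈-refl A B C i α β δ ⟩
        A * i * α + B * i * β + C * i * δ ∎

    position : x ≈ₚ s *ₚ a +ₚ t *ₚ b +ₚ u *ₚ d
    position = divide (proj₁ (cramer a b d x)) , divide (proj₂ (cramer a b d x))

    inside : Inside a b d x → InOpenTriangle a b d x
    inside (0<C , 0<A , 0<B) =
      s , t , u , *-pos 0<A 0<i , *-pos 0<B 0<i , *-pos 0<C 0<i , total , position

    on-side : Within a b d x → C ≈ 0# → InSegment a b x
    on-side (_ , 0≤A , 0≤B) C≈0 =
      s , t , *-nonneg 0≤A (inj₁ 0<i) , *-nonneg 0≤B (inj₁ 0<i) ,
      ≈-trans (≈-sym (+-identityʳ _)) (≈-trans (+-congˡ (≈-sym u≈0)) total) ,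
      coordinate (proj₁ position) , coordinate (proj₂ position)
      where
      u≈0 : u ≈ 0#
      u≈0 = ≈-trans (*-congʳ C≈0) (zeroˡ i)
      coordinate : ∀ {x y z} → x ≈ y + u * z → x ≈ y
      coordinate {x} {y} {z} x≈ = ≈-trans x≈
        (≈-trans (+-congˡ (≈-trans (*-congʳ u≈0) (zeroˡ z))) (+-identityʳ y))

  open Barycentric public using () renaming (inside to inside⇒open; on-side to within⇒side)

  open-rotate : ∀ {a b d x} → InOpenTriangle a b d x → InOpenTriangle b d a x
  open-rotate (s , t , u , 0<s , 0<t , 0<u , total , x₁≈ , x₂≈) =
    t , u , s , 0<t , 0<u , 0<s , ≈-trans (cycle s t u) total ,
    ≈-trans x₁≈ (≈-sym (cycle _ _ _)) , ≈-trans x₂≈ (≈-sym (cycle _ _ _))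
    where
    cycle : ∀ s t u → t + u + s ≈ s + t + u
    cycle = solve 3 (λ s t u → t :+ u :+ s := s :+ t :+ u) ≈-refl

  open-swap : ∀ {a b d x} → InOpenTriangle a b d x → InOpenTriangle b a d x
  open-swap (s , t , u , 0<s , 0<t , 0<u , total , x₁≈ , x₂≈) =
    t , s , u , 0<t , 0<s , 0<u , ≈-trans (+-congʳ (+-comm t s)) total ,
    ≈-trans x₁≈ (+-congʳ (+-comm _ _)) , ≈-trans x₂≈ (+-congʳ (+-comm _ _))

  orient-affine₃ : ∀ a b {u v w z s t r} → s + t + r ≈ 1# → z ≈ₚ s *ₚ u +ₚ t *ₚ v +ₚ r *ₚ w →
                   orient a b z ≈ s * orient a b u + t * orient a b v + r * orient a b w
  orient-affine₃ a@(ax , ay) b@(bx , by) {u@(ux , uy)} {v@(vx , vy)} {w@(wx , wy)} {z} {s} {t} {r}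
                 total z≈ = begin
    orient a b z                              ≈⟨ orient-cong a b z≈ ⟩
    orient a b (s *ₚ u +ₚ t *ₚ v +ₚ r *ₚ w)   ≈⟨ identity ⟩
    σ + ((s + t + r) * k - k)                 ≈⟨ +-congˡ (cancel k total) ⟩
    σ + 0#                                    ≈⟨ +-identityʳ _ ⟩
    σ                                         ∎
    where
    k = (bx - ax) * ay - (by - ay) * ax
    σ = s * orient a b u + t * orient a b v + r * orient a b w
    identity : orient a b (s *ₚ u +ₚ t *ₚ v +ₚ r *ₚ w) ≈ σ + ((s + t + r) * k - k)
    identity = solve 13 (λ ax ay bx by ux uy vx vy wx wy s t r →
      let k = (bx :- ax) :* ay :- (by :- ay) :* ax in
      orientᵖ ax ay bx by (s :* ux :+ t :* vx :+ r :* wx) (s :* uy :+ t :* vy :+ r :* wy) :=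
      s :* orientᵖ ax ay bx by ux uy :+ t :* orientᵖ ax ay bx by vx vy :+
      r :* orientᵖ ax ay bx by wx wy :+ ((s :+ t :+ r) :* k :- k))
      ≈-refl ax ay bx by ux uy vx vy wx wy s t r

  triangle-nonneg : ∀ c e {a b d x} → InOpenTriangle a b d x →
                    0# ≤ orient c e a → 0# ≤ orient c e b → 0# ≤ orient c e d → 0# ≤ orient c e x
  triangle-nonneg c e {a} {b} {d} {x} (s , t , u , 0<s , 0<t , 0<u , total , x≈) 0≤a 0≤b 0≤d =
    nonneg-resp (≈-sym (orient-affine₃ c e {a} {b} {d} {x} total x≈))
      (+-nonneg (+-nonneg (*-nonneg (inj₁ 0<s) 0≤a) (*-nonneg (inj₁ 0<t) 0≤b))
                (*-nonneg (inj₁ 0<u) 0≤d))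

  open⇒pos : ∀ {a b d x} → 0# < orient a b d → InOpenTriangle a b d x → 0# < orient a b x
  open⇒pos {a} {b} {d} {x} 0<O (s , t , u , _ , _ , 0<u , total , x≈) =
    pos-resp (≈-sym eq) (*-pos 0<u 0<O)
    where
    eq : orient a b x ≈ u * orient a b d
    eq = begin
      orient a b x
        ≈⟨ orient-affine₃ a b {a} {b} {d} {x} total x≈ ⟩
      s * orient a b a + t * orient a b b + u * orient a b d
        ≈⟨ +-congʳ (+-cong (≈-trans (*-congˡ (orient-aba a b)) (zeroʳ s))
                           (≈-trans (*-congˡ (orient-abb a b)) (zeroʳ t))) ⟩
      0# + 0# + u * orient a b d                                ≈⟨ +-congʳ (+-identityˡ 0#) ⟩
      0# + u * orient a b d                                     ≈⟨ +-identityˡ _ ⟩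
      u * orient a b d                                          ∎

  open⇒inside : ∀ {a b d x} → 0# < orient a b d → InOpenTriangle a b d x → Inside a b d x
  open⇒inside {a} {b} {d} 0<O x∈ =
    open⇒pos 0<O x∈ ,
    open⇒pos (pos-resp (≈-sym (orient-rotate a b d)) 0<O) (open-rotate x∈) ,
    open⇒pos (pos-resp (≈-sym (orient-cycle a b d)) 0<O) (open-rotate (open-rotate x∈))

  clip : ∀ a b {x} y → 0# < orient a b x →
         ∃[ z ] InSegment x y z × (0# ≤ orient a b z) × ((z ≡ y) ⊎ (orient a b z ≈ 0#))
  clip a b {x} y 0<x = cases (sign (orient a b y))
    where
    cases : Sign (orient a b y) →
            ∃[ z ] InSegment x y z × (0# ≤ orient a b z) × ((z ≡ y) ⊎ (orient a b z ≈ 0#))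
    cases (pos 0<y)  = y , segment-end x y , inj₁ 0<y , inj₁ refl
    cases (null y≈0) = y , segment-end x y , ≈0⇒≥0 y≈0 , inj₁ refl
    cases (neg 0<-y) =
      let z , z∈xy , z≈0 = segment-cross a b {x} {y} 0<x 0<-y
      in z , z∈xy , ≈0⇒≥0 z≈0 , inj₂ z≈0

  -- Walking from an interior point x towards y, clip against the three sides in
  -- turn; the last clip that takes effect leaves the point on the boundary.
  exit : ∀ {a b d x y} → Inside a b d x → ¬ Inside a b d y →
         ∃[ z ] InSegment x y z × Within a b d z ×
                ((orient a b z ≈ 0#) ⊎ (orient b d z ≈ 0#) ⊎ (orient d a z ≈ 0#))
  exit {a} {b} {d} {x} {y} (0<C , 0<A , 0<B) y∉
    with clip a b y 0<C
  ... | z₁ , z₁∈ , 0≤C₁ , cut₁ with clip b d z₁ 0<A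
  ... | z₂ , z₂∈ , 0≤A₂ , cut₂ with clip d a z₂ 0<B
  ... | z₃ , z₃∈ , 0≤B₃ , cut₃ =
    z₃ , towards z₃∈ z₂∈y , (0≤C₃ , 0≤A₃ , 0≤B₃) , boundary cut₁ cut₂ cut₃
    where
    towards : ∀ {y z w} → InSegment x z w → InSegment x y z → InSegment x y w
    towards w∈ z∈ = segment-sym (segment-trans (segment-sym z∈) (segment-sym w∈))
    z₂∈y = towards z₂∈ z₁∈
    -- A later clip moves the point back towards `x`, hence never out of a half-plane that was
    -- already secured.
    0≤C₂ = segment-nonneg a b z₂∈ (inj₁ 0<C) 0≤C₁
    0≤C₃ = segment-nonneg a b z₃∈ (inj₁ 0<C) 0≤C₂
    0≤A₃ = segment-nonneg b d z₃∈ (inj₁ 0<A) 0≤A₂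
    Boundary = (orient a b z₃ ≈ 0#) ⊎ (orient b d z₃ ≈ 0#) ⊎ (orient d a z₃ ≈ 0#)
    boundary : (z₁ ≡ y) ⊎ (orient a b z₁ ≈ 0#) → (z₂ ≡ z₁) ⊎ (orient b d z₂ ≈ 0#) →
               (z₃ ≡ z₂) ⊎ (orient d a z₃ ≈ 0#) → Boundary
    boundary _           _           (inj₂ B≈0)  = inj₂ (inj₂ B≈0)
    boundary _           (inj₂ A≈0)  (inj₁ refl) = inj₂ (inj₁ A≈0)
    boundary (inj₂ C≈0)  (inj₁ refl) (inj₁ refl) = inj₁ C≈0
    -- No clip took effect, so the point is `y` itself; it is within the triangle but not inside,
    -- which forces one of the orientations to vanish.
    boundary (inj₁ refl) (inj₁ refl) (inj₁ refl) = case₁ 0≤C₃ 0≤A₃ 0≤B₃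
      where
      case₁ : 0# ≤ orient a b z₃ → 0# ≤ orient b d z₃ → 0# ≤ orient d a z₃ → Boundary
      case₁ (inj₂ 0≈C) _          _          = inj₁ (≈-sym 0≈C)
      case₁ (inj₁ _)   (inj₂ 0≈A) _          = inj₂ (inj₁ (≈-sym 0≈A))
      case₁ (inj₁ _)   (inj₁ _)   (inj₂ 0≈B) = inj₂ (inj₂ (≈-sym 0≈B))
      case₁ (inj₁ 0<C) (inj₁ 0<A) (inj₁ 0<B) = contradiction (0<C , 0<A , 0<B) y∉

-- Faces of planar edge sets

module PlanarSubdivisions {c ℓ₁ ℓ₂} (ℝ : RealNumbers c ℓ₁ ℓ₂) {n} (P : Plane.PointSet ℝ n) where
  open RealNumbers ℝ
  open Plane ℝ
  open Triangulations ℝ P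
  open Geometry ℝ
  open Edge

  orientᵛ : Fin n → Fin n → Fin n → Carrier
  orientᵛ a b d = orient (point a) (point b) (point d)

  infix 4 _≟ᵉ_
  _≟ᵉ_ : (e e′ : Edge n) → Dec (e ≡ e′)
  edge lo hi _ ≟ᵉ edge lo′ hi′ _ with lo Fin.≟ lo′ | hi Fin.≟ hi′
  ... | yes refl | yes refl = yes refl
  ... | no lo≢   | _        = no λ { refl → lo≢ refl }
  ... | yes _    | no hi≢   = no λ { refl → hi≢ refl }

  -- Opposite orders of `a` and `b` would give both `a < b` and `b < a`; these proofs are
  -- irrelevant, hence the irrelevant elimination.
  joins-unique : ∀ {e e′ a b} → Joins e a b → Joins e′ a b → e ≡ e′
  joins-unique (inj₁ (refl , refl)) (inj₁ (refl , refl)) = refl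
  joins-unique (inj₂ (refl , refl)) (inj₂ (refl , refl)) = refl
  joins-unique {edge _ _ p} {edge _ _ q} (inj₁ (refl , refl)) (inj₂ (refl , refl)) =
    Irrelevant.⊥-elim (Fin.<-asym p q)
  joins-unique {edge _ _ p} {edge _ _ q} (inj₂ (refl , refl)) (inj₁ (refl , refl)) =
    Irrelevant.⊥-elim (Fin.<-asym p q)

  joins-lohi : ∀ e → Joins e (lo e) (hi e)
  joins-lohi e = inj₁ (refl , refl)

  endpoint⇒ : ∀ e {a b v} → Joins e a b → v EndpointOf e → (v ≡ a) ⊎ (v ≡ b)
  endpoint⇒ e (inj₁ (refl , refl)) v∈ = v∈
  endpoint⇒ e (inj₂ (refl , refl)) v∈ = swap v∈

  endpoint⇐ : ∀ e {a b v} → Joins e a b → (v ≡ a) ⊎ (v ≡ b) → v EndpointOf e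
  endpoint⇐ e (inj₁ (refl , refl)) v∈ = v∈
  endpoint⇐ e (inj₂ (refl , refl)) v∈ = swap v∈

  on⇐ : ∀ e {a b} x → Joins e a b → InSegment (point a) (point b) x → x On e
  on⇐ e x (inj₁ (refl , refl)) x∈ = x∈
  on⇐ e x (inj₂ (refl , refl)) x∈ = segment-sym x∈

  on⇒ : ∀ e {a b} x → Joins e a b → x On e → InSegment (point a) (point b) x
  on⇒ e x (inj₁ (refl , refl)) x∈ = x∈
  on⇒ e x (inj₂ (refl , refl)) x∈ = segment-sym x∈

  on-resp : ∀ e {x y} → x ≈ₚ y → x On e → y On e
  on-resp e (x₁≈ , x₂≈) (s , t , 0≤s , 0≤t , s+t≈1 , e₁ , e₂) =
    s , t , 0≤s , 0≤t , s+t≈1 , ≈-trans (≈-sym x₁≈) e₁ , ≈-trans (≈-sym x₂≈) e₂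

  module _ {S : EdgeSet} (planar : Planar S) where
    open Planar planar

    vertex-on-edge : ∀ {e a b v} → Joins e a b → e ∈ S → InSegment (point a) (point b) (point v) →
                     (v ≡ a) ⊎ (v ≡ b)
    vertex-on-edge {e} {v = v} j e∈S v∈ =
      endpoint⇒ e j (noVertexInside e∈S v (on⇐ e (point v) j v∈))

    common-endpoint : ∀ {e e′ a b u w} → Joins e a b → Joins e′ u w →
                      e ∈ S → e′ ∈ S → e ≢ e′ → ∀ x →
                      InSegment (point a) (point b) x → InSegment (point u) (point w) x →
                      ∃[ v ] ((v ≡ a) ⊎ (v ≡ b)) × ((v ≡ u) ⊎ (v ≡ w)) × x ≈ₚ point v
    common-endpoint {e} {e′} j j′ e∈S e′∈S e≢e′ x x∈ x∈′ =
      let v , v∈e , v∈e′ , x≈v = noCrossing e∈S e′∈S e≢e′ x (on⇐ e x j x∈) (on⇐ e′ x j′ x∈′)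
      in v , endpoint⇒ e j v∈e , endpoint⇒ e′ j′ v∈e′ , x≈v

  -- `S` enters only through the membership of three edges, so a face passes to every edge set that
  -- contains its sides. The counterclockwise order fixes on which side of an edge the face lies.
  record Face (S : EdgeSet) (a b d : Fin n) : Set ℓ₂ where
    field
      ccw         : 0# < orientᵛ a b d
      ab bd da    : Edge n
      joins-ab    : Joins ab a b
      joins-bd    : Joins bd b d
      joins-da    : Joins da d a
      ab∈ : ab ∈ S
      bd∈ : bd ∈ S
      da∈ : da ∈ S
      empty       : ∀ v → ¬ Inside (point a) (point b) (point d) (point v)

  face-rotate : ∀ {S a b d} → Face S a b d → Face S b d a
  face-rotate {S} {a} {b} {d} f = record
    { ccw = pos-resp (≈-sym (orient-rotate (point a) (point b) (point d))) ccw
    ; joins-ab = joins-bd ; joins-bd = joins-da ; joins-da = joins-ab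
    ; ab∈ = bd∈ ; bd∈ = da∈ ; da∈ = ab∈
    ; empty = λ v (x , y , z) → empty v (z , x , y)
    }
    where open Face f

  data Corner (a b d v : Fin n) : Set where
    first  : v ≡ a → Corner a b d v
    second : v ≡ b → Corner a b d v
    third  : v ≡ d → Corner a b d v

  corner-rotate : ∀ {a b d v} → Corner b d a v → Corner a b d v
  corner-rotate (first  v≡b) = second v≡b
  corner-rotate (second v≡d) = third v≡d
  corner-rotate (third  v≡a) = first v≡a

  endpoint⇒corner : ∀ {a b d v} → (v ≡ a) ⊎ (v ≡ b) → Corner a b d v
  endpoint⇒corner = Sum.[ first , second ]

  Withinᵛ : Fin n → Fin n → Fin n → Point → Set (ℓ₁ ⊔ ℓ₂)
  Withinᵛ a b d = Within (point a) (point b) (point d)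

  Insideᵛ : Fin n → Fin n → Fin n → Point → Set ℓ₂
  Insideᵛ a b d = Inside (point a) (point b) (point d)

  -- A vertex of the closed triangle that is not inside lies on a side, where planarity admits only
  -- endpoints. Rotating the face reduces the other two sides to the first.
  face-closed : ∀ {S a b d} → Planar S → Face S a b d →
                ∀ v → Withinᵛ a b d (point v) → Corner a b d v
  face-closed {S} {a} {b} {d} planar f v within@(C , A , B) = cases C A B
    where
    side : ∀ {a b d} (f : Face S a b d) → Withinᵛ a b d (point v) → orientᵛ a b v ≈ 0# →
           Corner a b d v
    side f within z = endpoint⇒corner (vertex-on-edge planar (Face.joins-ab f) (Face.ab∈ f)
                        (within⇒side (Face.ccw f) (point v) within z))
    cases : 0# ≤ orientᵛ a b v → 0# ≤ orientᵛ b d v → 0# ≤ orientᵛ d a v → Corner a b d v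
    cases (inj₂ 0≈C) _          _          = side f within (≈-sym 0≈C)
    cases _          (inj₂ 0≈A) _          = corner-rotate
      (side (face-rotate f) (A , B , C) (≈-sym 0≈A))
    cases _          _          (inj₂ 0≈B) = corner-rotate (corner-rotate
      (side (face-rotate (face-rotate f)) (B , C , A) (≈-sym 0≈B)))
    cases (inj₁ 0<C) (inj₁ 0<A) (inj₁ 0<B) = contradiction (0<C , 0<A , 0<B) (Face.empty f v)

  -- Followed from a point inside a face towards either end, an edge leaves the
  -- face through a common endpoint; hence both its ends are corners.
  no-edge-inside : ∀ {S a b d h} → Planar S → Face S a b d → h ∈ S →
                   ∀ x → x On h → ¬ Insideᵛ a b d x
  no-edge-inside {S} {a} {b} {d} {h} planar f h∈S x x∈h inside =
    flat (end (swap (joins-lohi h)) (segment-sym x∈h)) (end (joins-lohi h) x∈h)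
    where
    pt = point
    side : ∀ {a b d w u z} → Face S a b d → Insideᵛ a b d x →
           Joins h w u → InSegment (pt w) (pt u) x → InSegment x (pt u) z →
           Withinᵛ a b d z → orient (pt a) (pt b) z ≈ 0# → Corner a b d u
    side {a} {b} {d} {w} {u} {z} f (0<C , _) j x∈ z∈ within z≈0 =
      cases (common-endpoint planar (Face.joins-ab f) j (Face.ab∈ f) h∈S ab≢h z
               (within⇒side (Face.ccw f) z within z≈0)
               (segment-trans {pt w} {pt u} {x} {z} x∈ z∈))
      where
      ab≢h : Face.ab f ≢ h
      ab≢h refl = pos⇒≉0 0<C (segment⇒collinear (pt a) (pt b) {x} (on⇒ h x (Face.joins-ab f) x∈h))
      cases : ∃[ v ] ((v ≡ a) ⊎ (v ≡ b)) × ((v ≡ w) ⊎ (v ≡ u)) × z ≈ₚ pt v → Corner a b d u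
      cases (v , v∈ab , inj₂ refl , _)  = endpoint⇒corner v∈ab
      -- The edge cannot leave through the end `w` that it comes from: then `w` would lie on the
      -- line `a b` and `u` not strictly to its left, so neither could the point `x` between them.
      cases (v , v∈ab , inj₁ refl , z≈) =
        contradiction (beyond (pos-or-nonneg (orientᵛ a b u))) (pos⇒-≱0 0<C)
        where
        w≈0 : orientᵛ a b w ≈ 0#
        w≈0 = ≈-trans (≈-sym (orient-cong (pt a) (pt b) z≈)) z≈0
        minus : ∀ y → 0# ≤ - orient (pt a) (pt b) y → 0# ≤ orient (pt b) (pt a) y
        minus y = nonneg-resp (≈-sym (orient-swap (pt a) (pt b) y))
        beyond : (0# < orientᵛ a b u) ⊎ (0# ≤ - orientᵛ a b u) → 0# ≤ - orient (pt a) (pt b) x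
        beyond (inj₁ 0<u)  =
          contradiction 0<u (segment-zero (pt a) (pt b) {x} {pt u} {z} z∈ 0<C z≈0)
        beyond (inj₂ 0≤-u) = nonneg-resp (orient-swap (pt a) (pt b) x)
          (segment-nonneg (pt b) (pt a) {pt w} {pt u} {x} x∈
            (minus (pt w) (≈0⇒-≥0 w≈0)) (minus (pt u) 0≤-u))
    end : ∀ {w u} → Joins h w u → InSegment (pt w) (pt u) x → Corner a b d u
    end {w} {u} j x∈ = cases (exit {pt a} {pt b} {pt d} {x} {pt u} inside (Face.empty f u))
      where
      cases : ∃[ z ] InSegment x (pt u) z × Withinᵛ a b d z ×
                ((orient (pt a) (pt b) z ≈ 0#) ⊎ (orient (pt b) (pt d) z ≈ 0#) ⊎
                 (orient (pt d) (pt a) z ≈ 0#)) → Corner a b d u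
      cases (z , z∈ , within , inj₁ C≈0) = side f inside j x∈ z∈ within C≈0
      cases (z , z∈ , (C , A , B) , inj₂ (inj₁ A≈0)) =
        let C′ , A′ , B′ = inside in
        corner-rotate (side (face-rotate f) (A′ , B′ , C′) j x∈ z∈ (A , B , C) A≈0)
      cases (z , z∈ , (C , A , B) , inj₂ (inj₂ B≈0)) =
        let C′ , A′ , B′ = inside in
        corner-rotate (corner-rotate
          (side (face-rotate (face-rotate f)) (B′ , C′ , A′) j x∈ z∈ (B , C , A) B≈0))
    on-line : ∀ u w → (u ≡ lo h) → (w ≡ hi h) → ∀ a b → 0# < orient (pt a) (pt b) x →
              ¬ ((orientᵛ a b u ≈ 0#) × (orientᵛ a b w ≈ 0#))
    on-line _ _ refl refl a b 0<x (u≈0 , w≈0) =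
      pos⇒≉0 0<x (segment-null (pt a) (pt b) {pt (lo h)} {pt (hi h)} {x} x∈h u≈0 w≈0)
    -- Any two corners lie on the line of a common side, which would then contain all of `h`,
    -- whereas `x` is strictly to the left of every side.
    flat : Corner a b d (lo h) → ¬ Corner a b d (hi h)
    flat l r = cases l r
      where
      0<C = proj₁ inside
      0<A = proj₁ (proj₂ inside)
      0<B = proj₂ (proj₂ inside)
      C₁ = orient-aba (pt a) (pt b)
      C₂ = orient-abb (pt a) (pt b)
      A₁ = orient-aba (pt b) (pt d)
      A₂ = orient-abb (pt b) (pt d)
      B₁ = orient-aba (pt d) (pt a)
      B₂ = orient-abb (pt d) (pt a)
      cases : Corner a b d (lo h) → ¬ Corner a b d (hi h)
      cases (first  l) (first  r) = on-line a a (sym l) (sym r) a b 0<C (C₁ , C₁)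
      cases (first  l) (second r) = on-line a b (sym l) (sym r) a b 0<C (C₁ , C₂)
      cases (first  l) (third  r) = on-line a d (sym l) (sym r) d a 0<B (B₂ , B₁)
      cases (second l) (first  r) = on-line b a (sym l) (sym r) a b 0<C (C₂ , C₁)
      cases (second l) (second r) = on-line b b (sym l) (sym r) b d 0<A (A₁ , A₁)
      cases (second l) (third  r) = on-line b d (sym l) (sym r) b d 0<A (A₁ , A₂)
      cases (third  l) (first  r) = on-line d a (sym l) (sym r) d a 0<B (B₁ , B₂)
      cases (third  l) (second r) = on-line d b (sym l) (sym r) b d 0<A (A₂ , A₁)
      cases (third  l) (third  r) = on-line d d (sym l) (sym r) d a 0<B (B₁ , B₁)

  triangle⇒face : ∀ {T a b d} → Triangle T a b d → 0# < orientᵛ a b d → Face (edges T) a b d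
  triangle⇒face {T} {a} {b} {d} t ccw =
    let ab , joins-ab , ab∈ = side₁
        bd , joins-bd , bd∈ = side₂
        da , joins-da , da∈ = side₃
    in record
      { ccw = ccw ; ab = ab ; bd = bd ; da = da
      ; joins-ab = joins-ab ; joins-bd = joins-bd ; joins-da = joins-da
      ; ab∈ = ab∈ ; bd∈ = bd∈ ; da∈ = da∈
      ; empty = λ v v∈ → noVertex v (inside⇒open ccw (point v) v∈)
      }
    where open Triangle t

  triangle-swap : ∀ {T a b d} → Triangle T a b d → Triangle T b a d
  triangle-swap {T} {a} {b} {d} t = record
    { nondegenerate = λ z → nondegenerate (≈-trans (≈-sym (-‿involutive _))
        (≈-trans (-‿cong (≈-trans (≈-sym (orient-swap (point a) (point b) (point d))) z)) -0#≈0#))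
    ; side₁ = reverse side₁ ; side₂ = reverse side₃ ; side₃ = reverse side₂
    ; noVertex = λ v v∈ → noVertex v (open-swap {point b} {point a} {point d} {point v} v∈)
    ; noEdge = λ e∈T x x∈e x∈ → noEdge e∈T x x∈e (open-swap {point b} {point a} {point d} {x} x∈)
    }
    where
    open Triangle t
    reverse : ∀ {u w} → ∃[ e ] Joins e u w × e ∈ edges T → ∃[ e ] Joins e w u × e ∈ edges T
    reverse (e , j , e∈T) = e , swap j , e∈T

  face⇒triangle : ∀ {a b d} T → Face (edges T) a b d → Triangle T a b d
  face⇒triangle {a} {b} {d} T f = record
    { nondegenerate = pos⇒≉0 ccw
    ; side₁ = ab , joins-ab , ab∈
    ; side₂ = bd , joins-bd , bd∈
    ; side₃ = da , joins-da , da∈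
    ; noVertex = λ v v∈ → empty v (open⇒inside ccw v∈)
    ; noEdge = λ e∈T x x∈e x∈ → no-edge-inside (planar T) f e∈T x x∈e (open⇒inside ccw x∈)
    }
    where open Face f

  SharesFace : EdgeSet → Edge n → Edge n → Set ℓ₂
  SharesFace S e e′ = (e ≢ e′) ×
    ∃[ a ] ∃[ b ] ∃[ d ] Face S a b d × SideOf e a b d × SideOf e′ a b d

  side-swap : ∀ e {a b d} → SideOf e a b d → SideOf e b a d
  side-swap e (inj₁ j)        = inj₁ (swap j)
  side-swap e (inj₂ (inj₁ j)) = inj₂ (inj₂ (swap j))
  side-swap e (inj₂ (inj₂ j)) = inj₂ (inj₁ (swap j))

  -- A `Triangle` may be listed clockwise; exchanging its first two vertices makes it a `Face` with
  -- the same sides.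
  share⇒ : ∀ {T e e′} → ShareTriangle T e e′ → SharesFace (edges T) e e′
  share⇒ {T} {e} {e′} (e≢e′ , a , b , d , t , s , s′) = e≢e′ , cases (sign (orientᵛ a b d))
    where
    cases : Sign (orientᵛ a b d) →
            ∃[ a ] ∃[ b ] ∃[ d ] Face (edges T) a b d × SideOf e a b d × SideOf e′ a b d
    cases (pos 0<O)  = a , b , d , triangle⇒face {T} t 0<O , s , s′
    cases (null O≈0) = contradiction O≈0 (Triangle.nondegenerate t)
    cases (neg 0<-O) = b , a , d ,
      triangle⇒face {T} (triangle-swap {T} t)
        (pos-resp (≈-sym (orient-swap (point a) (point b) (point d))) 0<-O) ,
      side-swap e s , side-swap e′ s′

  share⇐ : ∀ {e e′} T → SharesFace (edges T) e e′ → ShareTriangle T e e′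
  share⇐ T (e≢e′ , a , b , d , f , s , s′) = e≢e′ , a , b , d , face⇒triangle T f , s , s′

  face-⊆ : ∀ {S S′ a b d} → Face S a b d →
           (∀ {e} → SideOf e a b d → e ∈ S → e ∈ S′) → Face S′ a b d
  face-⊆ f keep = record
    { Face f
    ; ab∈ = keep (inj₁ joins-ab) ab∈
    ; bd∈ = keep (inj₂ (inj₁ joins-bd)) bd∈
    ; da∈ = keep (inj₂ (inj₂ joins-da)) da∈
    }
    where open Face f

  rotateᵛ : ∀ a b d → 0# < orientᵛ a b d → 0# < orientᵛ b d a
  rotateᵛ a b d = pos-resp (≈-sym (orient-rotate (point a) (point b) (point d)))

  swapᵛ : ∀ a b d → 0# < orientᵛ a b d → 0# < - orientᵛ b a d
  swapᵛ a b d = pos-resp (≈-trans (≈-sym (-‿involutive _))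
    (-‿cong (≈-sym (orient-swap (point a) (point b) (point d)))))

  -- Convex quadrilaterals and uniqueness of the face on a side of an edge

  Convexᵛ : Fin n → Fin n → Fin n → Fin n → Set ℓ₂
  Convexᵛ p q r s = ConvexQuadrilateral (point p) (point q) (point r) (point s)

  convex-rotate : ∀ {p q r s} → Convexᵛ p q r s → Convexᵛ q r s p
  convex-rotate (pqr , qrs , rsp , spq) = qrs , rsp , spq , pqr

  distinct₁ : ∀ {a b d} → 0# < orientᵛ a b d → a ≢ b
  distinct₁ {a} {b} {d} 0<O refl = pos⇒≉0 0<O (orient-aab (point a) (point d))

  distinct₂ : ∀ {a b d} → 0# < orientᵛ a b d → b ≢ d
  distinct₂ {a} {b} {d} 0<O refl = pos⇒≉0 0<O (orient-abb (point a) (point b))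

  distinct₃ : ∀ {a b d} → 0# < orientᵛ a b d → d ≢ a
  distinct₃ {a} {b} {d} 0<O refl = pos⇒≉0 0<O (orient-aba (point a) (point b))

  diagonals-disjoint : ∀ {p q r s v} → Convexᵛ p q r s → (v ≡ p) ⊎ (v ≡ r) → ¬ ((v ≡ q) ⊎ (v ≡ s))
  diagonals-disjoint (pqr , _ , _ , spq) (inj₁ refl) (inj₁ p≡q) = distinct₁ pqr p≡q
  diagonals-disjoint (pqr , _ , _ , spq) (inj₁ refl) (inj₂ p≡s) = distinct₁ spq (sym p≡s)
  diagonals-disjoint (pqr , _ , rsp , _) (inj₂ refl) (inj₁ r≡q) = distinct₂ pqr (sym r≡q)
  diagonals-disjoint (pqr , _ , rsp , _) (inj₂ refl) (inj₂ r≡s) = distinct₁ rsp r≡s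

  diagonals-differ : ∀ {p q r s e e′} → Convexᵛ p q r s → Joins e p r → Joins e′ q s → e ≢ e′
  diagonals-differ {p = p} {e = e} convex j j′ refl =
    diagonals-disjoint convex (inj₁ refl) (endpoint⇒ e j′ (endpoint⇐ e j (inj₁ refl)))

  -- `p` and `r` lie strictly on opposite sides of the line `q s`, so `pr` meets this line; the
  -- meeting point is in the closed triangle `q s p`, hence on the segment `qs`. Planarity would
  -- provide a common endpoint, but the diagonals have none.
  diagonals-cross : ∀ {S p q r s e e′} → Planar S → Convexᵛ p q r s → Joins e p r → Joins e′ q s →
                    e ∈ S → ¬ (e′ ∈ S)
  diagonals-cross {S} {p} {q} {r} {s} {e} {e′} planar convex@(pqr , qrs , rsp , spq) j j′ e∈S e′∈S =
    let v , v∈pr , v∈qs , _ =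
          common-endpoint planar j j′ e∈S e′∈S (diagonals-differ convex j j′) x x∈pr x∈qs
    in diagonals-disjoint convex v∈pr v∈qs
    where
    pt = point
    qsp : 0# < orientᵛ q s p
    qsp = rotateᵛ p q s (rotateᵛ s p q spq)
    crossing : ∃[ x ] InSegment (pt p) (pt r) x × orient (pt q) (pt s) x ≈ 0#
    crossing = segment-cross (pt q) (pt s) {pt p} {pt r} qsp
      (swapᵛ s q r (rotateᵛ r s q (rotateᵛ q r s qrs)))
    x = proj₁ crossing
    x∈pr = proj₁ (proj₂ crossing)
    x∈qs : InSegment (pt q) (pt s) x
    x∈qs = within⇒side qsp x
      ( ≈0⇒≥0 (proj₂ (proj₂ crossing))
      , segment-nonneg (pt s) (pt p) {pt p} {pt r} {x} x∈pr (≈0⇒≥0 (orient-abb (pt s) (pt p)))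
          (inj₁ (rotateᵛ r s p rsp))
      , segment-nonneg (pt p) (pt q) {pt p} {pt r} {x} x∈pr (≈0⇒≥0 (orient-aba (pt p) (pt q)))
          (inj₁ pqr)
      ) (proj₂ (proj₂ crossing))

  -- Compare `d′` with the sides `da` and `bd`. If neither sign is negative, `d′` is in the first
  -- closed triangle; if neither is positive, `d` is in the second; `face-closed` then identifies
  -- them. With opposite strict signs, a side of one face and a side of the other are the diagonals
  -- of a convex quadrilateral.
  third-vertex-unique : ∀ {S a b d d′} → Planar S → Face S a b d → Face S a b d′ → d ≡ d′
  third-vertex-unique {S} {a} {b} {d} {d′} planar f f′ =
    cases (sign (orientᵛ d a d′)) (sign (orientᵛ b d d′))
    where
    open Face f using () renaming (ccw to abd)
    open Face f′ using () renaming (ccw to abd′)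
    flip-da : orientᵛ d′ a d ≈ - orientᵛ d a d′
    flip-da = ≈-trans (≈-sym (orient-rotate (point d′) (point a) (point d)))
                      (orient-swap (point d) (point a) (point d′))
    flip-bd : orientᵛ b d′ d ≈ - orientᵛ b d d′
    flip-bd = ≈-trans (orient-rotate (point d) (point b) (point d′))
                      (orient-swap (point b) (point d) (point d′))
    corner : ∀ {d d′} → 0# < orientᵛ a b d′ → Corner a b d d′ → d ≡ d′
    corner abd′ (first  d′≡a) = contradiction d′≡a (distinct₃ abd′)
    corner abd′ (second d′≡b) = contradiction (sym d′≡b) (distinct₂ abd′)
    corner abd′ (third  d′≡d) = sym d′≡d
    closed : 0# ≤ orientᵛ d a d′ → 0# ≤ orientᵛ b d d′ → d ≡ d′
    closed α β = corner abd′ (face-closed planar f d′ (inj₁ abd′ , β , α))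
    closed′ : 0# ≤ - orientᵛ d a d′ → 0# ≤ - orientᵛ b d d′ → d ≡ d′
    closed′ α β = sym (corner abd (face-closed planar f′ d
      (inj₁ abd , nonneg-resp (≈-sym flip-bd) β , nonneg-resp (≈-sym flip-da) α)))
    cases : Sign (orientᵛ d a d′) → Sign (orientᵛ b d d′) → d ≡ d′
    cases (pos α)  (pos β)  = closed (inj₁ α) (inj₁ β)
    cases (pos α)  (null β) = closed (inj₁ α) (≈0⇒≥0 β)
    cases (null α) (pos β)  = closed (≈0⇒≥0 α) (inj₁ β)
    cases (null α) (null β) = closed (≈0⇒≥0 α) (≈0⇒≥0 β)
    cases (null α) (neg β)  = closed′ (≈0⇒-≥0 α) (inj₁ β)
    cases (neg α)  (null β) = closed′ (inj₁ α) (≈0⇒-≥0 β)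
    cases (neg α)  (neg β)  = closed′ (inj₁ α) (inj₁ β)
    cases (pos α)  (neg β)  = contradiction (Face.bd∈ f)
      (diagonals-cross {p = a} {q = b} {r = d′} {s = d} planar
        ( abd′ , pos-resp (≈-sym flip-bd) β
        , rotateᵛ a d′ d (rotateᵛ d a d′ α) , rotateᵛ b d a (rotateᵛ a b d abd))
        (swap (Face.joins-da f′)) (Face.joins-bd f) (Face.da∈ f′))
    cases (neg α)  (pos β)  = contradiction (Face.bd∈ f′)
      (diagonals-cross {p = a} {q = b} {r = d} {s = d′} planar
        ( abd , β
        , rotateᵛ a d d′ (rotateᵛ d′ a d (pos-resp (≈-sym flip-da) α))
        , rotateᵛ b d′ a (rotateᵛ a b d′ abd′))
        (swap (Face.joins-da f)) (Face.joins-bd f′) (Face.da∈ f))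

  -- The part of a flip that does not depend on the triangulation.  A rotation by
  -- one vertex exchanges the diagonals, hence gives the inverse flip.
  record Quad : Set (ℓ₁ ⊔ ℓ₂) where
    field
      p q r s           : Fin n
      pq qr rs sp pr qs : Edge n
      joins-pq : Joins pq p q
      joins-qr : Joins qr q r
      joins-rs : Joins rs r s
      joins-sp : Joins sp s p
      joins-pr : Joins pr p r
      joins-qs : Joins qs q s
      convex   : Convexᵛ p q r s
      empty    : ∀ v → 0# ≤ orientᵛ p q v → 0# ≤ orientᵛ q r v → 0# ≤ orientᵛ r s v →
                 0# ≤ orientᵛ s p v → (v ≡ p) ⊎ (v ≡ q) ⊎ (v ≡ r) ⊎ (v ≡ s)

  -- The effect of a flip on an edge set

  Side : Quad → Edge n → Set
  Side Q e = (e ≡ pq) ⊎ (e ≡ qr) ⊎ (e ≡ rs) ⊎ (e ≡ sp)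
    where open Quad Q

  side? : ∀ Q e → Dec (Side Q e)
  side? Q e = (e ≟ᵉ pq) ⊎-dec (e ≟ᵉ qr) ⊎-dec (e ≟ᵉ rs) ⊎-dec (e ≟ᵉ sp)
    where open Quad Q

  rotate : Quad → Quad
  rotate Q = record
    { p = q ; q = r ; r = s ; s = p
    ; pq = qr ; qr = rs ; rs = sp ; sp = pq ; pr = qs ; qs = pr
    ; joins-pq = joins-qr ; joins-qr = joins-rs ; joins-rs = joins-sp ; joins-sp = joins-pq
    ; joins-pr = joins-qs ; joins-qs = swap joins-pr
    ; convex = convex-rotate convex
    ; empty = λ v qrv rsv spv pqv → cycle (empty v pqv qrv rsv spv)
    }
    where
    open Quad Q
    cycle : ∀ {v} → (v ≡ p) ⊎ (v ≡ q) ⊎ (v ≡ r) ⊎ (v ≡ s) →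
            (v ≡ q) ⊎ (v ≡ r) ⊎ (v ≡ s) ⊎ (v ≡ p)
    cycle = Sum.[ inj₂ ∘ inj₂ ∘ inj₂ , Sum.map₂ (Sum.map₂ inj₁) ]

  side-rotate : ∀ Q {e} → Side (rotate Q) e → Side Q e
  side-rotate Q (inj₁ e≡qr)               = inj₂ (inj₁ e≡qr)
  side-rotate Q (inj₂ (inj₁ e≡rs))        = inj₂ (inj₂ (inj₁ e≡rs))
  side-rotate Q (inj₂ (inj₂ (inj₁ e≡sp))) = inj₂ (inj₂ (inj₂ e≡sp))
  side-rotate Q (inj₂ (inj₂ (inj₂ e≡pq))) = inj₁ e≡pq

  HasSides : Quad → EdgeSet → Set
  HasSides Q S = ∀ {e} → Side Q e → e ∈ S

  Applies : Quad → EdgeSet → Set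
  Applies Q S = (Quad.pr Q ∈ S) × HasSides Q S

  -- The field `result` of `Performs`, stated for arbitrary edge sets because the maximality
  -- argument also undoes a flip in a planar superset.
  Replaced : Quad → EdgeSet → EdgeSet → Set
  Replaced Q S S′ = ∀ e → e ∈ S′ ⇔ ((e ∈ S × e ≢ Quad.pr Q) ⊎ e ≡ Quad.qs Q)

  -- A vertex inside `p q r` is in the quadrilateral, since `p`, `q`, `r` are all on the inner side
  -- of `rs` and `sp`. So it is one of the four corners, but none of these is inside: `s` lies
  -- beyond `rp`.
  pqr-face : ∀ {S} Q → Applies Q S → Face S (Quad.p Q) (Quad.q Q) (Quad.r Q)
  pqr-face Q (pr∈ , sides) = record
    { ccw = pqr ; ab = pq ; bd = qr ; da = pr
    ; joins-ab = joins-pq ; joins-bd = joins-qr ; joins-da = swap joins-pr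
    ; ab∈ = sides (inj₁ refl) ; bd∈ = sides (inj₂ (inj₁ refl)) ; da∈ = pr∈
    ; empty = λ v v∈@(pqv , qrv , rpv) →
        let v∈° = inside⇒open pqr (point v) v∈ in
        cases pqv qrv rpv (empty v (inj₁ pqv) (inj₁ qrv)
          (triangle-nonneg (point r) (point s) {point p} {point q} {point r} {point v} v∈°
            (inj₁ rsp) (inj₁ (rotateᵛ q r s qrs)) (≈0⇒≥0 (orient-aba (point r) (point s))))
          (triangle-nonneg (point s) (point p) {point p} {point q} {point r} {point v} v∈°
            (≈0⇒≥0 (orient-abb (point s) (point p))) (inj₁ spq) (inj₁ (rotateᵛ r s p rsp))))
    }
    where
    open Quad Q
    pqr = proj₁ convex
    qrs = proj₁ (proj₂ convex)
    rsp = proj₁ (proj₂ (proj₂ convex))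
    spq = proj₂ (proj₂ (proj₂ convex))
    cases : ∀ {v} → 0# < orientᵛ p q v → 0# < orientᵛ q r v → 0# < orientᵛ r p v →
            ¬ ((v ≡ p) ⊎ (v ≡ q) ⊎ (v ≡ r) ⊎ (v ≡ s))
    cases pqv _ _ (inj₁ v≡p) = distinct₃ pqv v≡p
    cases pqv _ _ (inj₂ (inj₁ v≡q)) = distinct₂ pqv (sym v≡q)
    cases _ qrv _ (inj₂ (inj₂ (inj₁ v≡r))) = distinct₂ qrv (sym v≡r)
    cases _ _ rps (inj₂ (inj₂ (inj₂ refl))) =
      pos⇒-≱0 rps (inj₁ (swapᵛ p r s (rotateᵛ s p r (rotateᵛ r s p rsp))))

  rsp-face : ∀ {S} Q → Applies Q S → Face S (Quad.r Q) (Quad.s Q) (Quad.p Q)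
  rsp-face Q (pr∈ , sides) = pqr-face (rotate (rotate Q))
    (pr∈ , λ e-side → sides (side-rotate Q (side-rotate (rotate Q) e-side)))

  -- By `third-vertex-unique` the only faces at `pr` are `p q r` and `r s p`. Sharing a face with
  -- the diagonal thus becomes a condition on the quadrilateral alone.
  face-at-diagonal : ∀ {S a b d h} Q → Planar S → Applies Q S → Face S a b d →
                     SideOf (Quad.pr Q) a b d → SideOf h a b d → h ≢ Quad.pr Q → Side Q h
  face-at-diagonal {S} {a} {b} {d} {h} Q planar applies f side h-side h≢pr = cases side h-side
    where
    open Quad Q
    core : ∀ {a b d} → Face S a b d → Joins pr a b → SideOf h a b d → Side Q h
    core f j (inj₁ j′) = contradiction (joins-unique j′ j) h≢pr
    core {a} {b} {d} f j (inj₂ h-side) = ends (endpoint⇒ pr joins-pr (endpoint⇐ pr j (inj₁ refl)))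
      (endpoint⇒ pr joins-pr (endpoint⇐ pr j (inj₂ refl))) f h-side
      where
      ends : ∀ {a b} → (a ≡ p) ⊎ (a ≡ r) → (b ≡ p) ⊎ (b ≡ r) → Face S a b d →
             Joins h b d ⊎ Joins h d a → Side Q h
      ends (inj₁ refl) (inj₁ refl) f _ = contradiction refl (distinct₁ (Face.ccw f))
      ends (inj₂ refl) (inj₂ refl) f _ = contradiction refl (distinct₁ (Face.ccw f))
      ends (inj₁ refl) (inj₂ refl) f h-side
        with third-vertex-unique planar f (face-rotate (face-rotate (rsp-face Q applies)))
      ... | refl = inj₂ (inj₂ (Sum.map (λ j → joins-unique j joins-rs)
                                       (λ j → joins-unique j joins-sp) h-side))
      ends (inj₂ refl) (inj₁ refl) f h-side
        with third-vertex-unique planar f (face-rotate (face-rotate (pqr-face Q applies)))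
      ... | refl = Sum.map (λ j → joins-unique j joins-pq)
                           (λ j → inj₁ (joins-unique j joins-qr)) h-side
    turn : ∀ {e a b d} → SideOf e a b d → SideOf e b d a
    turn (inj₁ j)        = inj₂ (inj₂ j)
    turn (inj₂ (inj₁ j)) = inj₁ j
    turn (inj₂ (inj₂ j)) = inj₂ (inj₁ j)
    cases : SideOf pr a b d → SideOf h a b d → Side Q h
    cases (inj₁ j)        h-side = core f j h-side
    cases (inj₂ (inj₁ j)) h-side = core (face-rotate f) j (turn {h} h-side)
    cases (inj₂ (inj₂ j)) h-side =
      core (face-rotate (face-rotate f)) j (turn {h} (turn {h} h-side))

  side-shares-face : ∀ {S h} Q → Applies Q S → Side Q h → h ≢ Quad.pr Q →
                     SharesFace S h (Quad.pr Q)
  side-shares-face {S} {h} Q applies side h≢pr = h≢pr , cases side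
    where
    open Quad Q
    pqr = pqr-face Q applies
    rsp = rsp-face Q applies
    cases : Side Q h →
            ∃[ a ] ∃[ b ] ∃[ d ] Face S a b d × SideOf h a b d × SideOf pr a b d
    cases (inj₁ refl) = p , q , r , pqr , inj₁ joins-pq , inj₂ (inj₂ (swap joins-pr))
    cases (inj₂ (inj₁ refl)) = p , q , r , pqr , inj₂ (inj₁ joins-qr) , inj₂ (inj₂ (swap joins-pr))
    cases (inj₂ (inj₂ (inj₁ refl))) = r , s , p , rsp , inj₁ joins-rs , inj₂ (inj₂ joins-pr)
    cases (inj₂ (inj₂ (inj₂ refl))) = r , s , p , rsp , inj₂ (inj₁ joins-sp) , inj₂ (inj₂ joins-pr)

  -- Every side ends at `q` or `s`, and the removed diagonal at neither.
  sides-survive : ∀ {S S′} Q → HasSides Q S → Replaced Q S S′ → HasSides Q S′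
  sides-survive {S} {S′} Q sides replaced {e} side =
    Equivalence.from (replaced e) (inj₁ (sides side , λ { refl → not-diagonal side }))
    where
    open Quad Q
    ends : ∀ {e a b} → pr ≡ e → Joins e a b → ((a ≡ p) ⊎ (a ≡ r)) × ((b ≡ p) ⊎ (b ≡ r))
    ends {a = a} {b} pr≡e j =
      endpoint⇒ pr joins-pr (endpoint⇐ pr j′ (inj₁ refl)) ,
      endpoint⇒ pr joins-pr (endpoint⇐ pr j′ (inj₂ refl))
      where j′ = subst (λ e → Joins e a b) (sym pr≡e) j
    q∉ : ¬ ((q ≡ p) ⊎ (q ≡ r))
    q∉ q∈ = diagonals-disjoint convex q∈ (inj₁ refl)
    s∉ : ¬ ((s ≡ p) ⊎ (s ≡ r))
    s∉ s∈ = diagonals-disjoint convex s∈ (inj₂ refl)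
    not-diagonal : ¬ Side Q pr
    not-diagonal (inj₁ pr≡pq)               = q∉ (proj₂ (ends pr≡pq joins-pq))
    not-diagonal (inj₂ (inj₁ pr≡qr))        = q∉ (proj₁ (ends pr≡qr joins-qr))
    not-diagonal (inj₂ (inj₂ (inj₁ pr≡rs))) = s∉ (proj₂ (ends pr≡rs joins-rs))
    not-diagonal (inj₂ (inj₂ (inj₂ pr≡sp))) = s∉ (proj₁ (ends pr≡sp joins-sp))

  resulting-∉ : ∀ {S} Q → Planar S → Quad.pr Q ∈ S → Quad.qs Q ∉ S
  resulting-∉ Q planar = diagonals-cross planar convex joins-pr joins-qs
    where open Quad Q

  -- Only `qs` is new. It stays in the closed quadrilateral, whose only vertices are the corners,
  -- and `p` and `r` are off its line; an old edge that met it between its ends would enter a face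
  -- at `pr` or cross `pr`.
  replaced-planar : ∀ {S S′} Q → Planar S → Applies Q S → Replaced Q S S′ → Planar S′
  replaced-planar {S} {S′} Q planar applies@(pr∈S , _) replaced = record
    { noVertexInside = λ {e} e∈S′ v v∈e → vertex e v v∈e (Equivalence.to (replaced e) e∈S′)
    ; noCrossing = λ {e} {e′} e∈S′ e′∈S′ e≢e′ x x∈e x∈e′ →
        crossing e e′ e≢e′ x x∈e x∈e′ (Equivalence.to (replaced e) e∈S′)
                                      (Equivalence.to (replaced e′) e′∈S′)
    }
    where
    open Quad Q
    open Planar planar
    pt = point
    pqr = proj₁ convex
    qrs = proj₁ (proj₂ convex)
    rsp = proj₁ (proj₂ (proj₂ convex))
    spq = proj₂ (proj₂ (proj₂ convex))
    pqs = rotateᵛ s p q spq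
    rsq = rotateᵛ q r s qrs
    qsp = rotateᵛ p q s pqs
    sqr = rotateᵛ r s q rsq

    vertex-on-qs : ∀ v → InSegment (pt q) (pt s) (pt v) → (v ≡ q) ⊎ (v ≡ s)
    vertex-on-qs v v∈ = cases (empty v
      (nonneg (pt p) (pt q) (≈0⇒≥0 (orient-abb (pt p) (pt q))) (inj₁ pqs))
      (nonneg (pt q) (pt r) (≈0⇒≥0 (orient-aba (pt q) (pt r))) (inj₁ qrs))
      (nonneg (pt r) (pt s) (inj₁ rsq) (≈0⇒≥0 (orient-abb (pt r) (pt s))))
      (nonneg (pt s) (pt p) (inj₁ spq) (≈0⇒≥0 (orient-aba (pt s) (pt p)))))
      where
      nonneg : ∀ a b → 0# ≤ orient a b (pt q) → 0# ≤ orient a b (pt s) → 0# ≤ orient a b (pt v)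
      nonneg a b = segment-nonneg a b {pt q} {pt s} {pt v} v∈
      line : orientᵛ q s v ≈ 0#
      line = segment⇒collinear (pt q) (pt s) {pt v} v∈
      cases : (v ≡ p) ⊎ (v ≡ q) ⊎ (v ≡ r) ⊎ (v ≡ s) → (v ≡ q) ⊎ (v ≡ s)
      cases (inj₁ refl)               = contradiction line (pos⇒≉0 qsp)
      cases (inj₂ (inj₁ v≡q))         = inj₁ v≡q
      cases (inj₂ (inj₂ (inj₁ refl))) = contradiction
        (≈-trans (orient-swap (pt q) (pt s) (pt r)) (≈-trans (-‿cong line) -0#≈0#)) (pos⇒≉0 sqr)
      cases (inj₂ (inj₂ (inj₂ v≡s)))  = inj₂ v≡s

    vertex : ∀ e v → pt v On e → (e ∈ S × e ≢ pr) ⊎ e ≡ qs → v EndpointOf e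
    vertex e v v∈e (inj₁ (e∈S , _)) = noVertexInside e∈S v v∈e
    vertex e v v∈e (inj₂ refl)      =
      endpoint⇐ qs joins-qs (vertex-on-qs v (on⇒ qs (pt v) joins-qs v∈e))

    -- A point of the open diagonal qs lies inside one of the two faces at pr or
    -- on pr itself.
    new : ∀ h → h ∈ S → h ≢ pr → ∀ x → x On h → InSegment (pt q) (pt s) x →
          ∃[ v ] v EndpointOf h × v EndpointOf qs × x ≈ₚ pt v
    new h h∈S h≢pr x x∈h (σ , τ , 0≤σ , 0≤τ , σ+τ≈1 , x≈) = cases 0≤σ 0≤τ
      where
      Common = ∃[ v ] v EndpointOf h × v EndpointOf qs × x ≈ₚ pt v
      at : ∀ v → (v ≡ q) ⊎ (v ≡ s) → x ≈ₚ pt v → Common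
      at v v∈qs x≈v =
        v , noVertexInside h∈S v (on-resp h x≈v x∈h) , endpoint⇐ qs joins-qs v∈qs , x≈v
      combination : ∀ a b → orient a b x ≈ σ * orient a b (pt q) + τ * orient a b (pt s)
      combination a b = orient-affine a b {pt q} {pt s} {x} σ+τ≈1 x≈
      left : ∀ a b → 0# < σ → 0# < orient a b (pt q) → 0# ≤ orient a b (pt s) → 0# < orient a b x
      left a b 0<σ 0<q 0≤s = pos-resp (≈-sym (combination a b))
        (+-pos-nonneg (*-pos 0<σ 0<q) (*-nonneg 0≤τ 0≤s))
      right : ∀ a b → 0# < τ → 0# ≤ orient a b (pt q) → 0# < orient a b (pt s) → 0# < orient a b x
      right a b 0<τ 0≤q 0<s = pos-resp (≈-sym (combination a b))
        (+-nonneg-pos (*-nonneg 0≤σ 0≤q) (*-pos 0<τ 0<s))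
      only : ∀ {s t y z w} → 0# ≈ s → s + t ≈ 1# → w ≈ s * y + t * z → w ≈ z
      only {s} {t} {y} {z} 0≈s s+t≈1 w≈ = ≈-trans w≈ (≈-trans
        (+-cong (≈-trans (*-congʳ (≈-sym 0≈s)) (zeroˡ y))
          (≈-trans (*-congʳ (≈-trans (≈-sym (≈-trans (+-congʳ (≈-sym 0≈s)) (+-identityˡ t))) s+t≈1))
                   (*-identityˡ z)))
        (+-identityˡ z))
      cases : 0# ≤ σ → 0# ≤ τ → Common
      cases (inj₂ 0≈σ) _          =
        at s (inj₂ refl) (only 0≈σ σ+τ≈1 (proj₁ x≈) , only 0≈σ σ+τ≈1 (proj₂ x≈))
      cases (inj₁ 0<σ) (inj₂ 0≈τ) = at q (inj₁ refl)
        ( only 0≈τ (≈-trans (+-comm τ σ) σ+τ≈1) (≈-trans (proj₁ x≈) (+-comm _ _))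
        , only 0≈τ (≈-trans (+-comm τ σ) σ+τ≈1) (≈-trans (proj₂ x≈) (+-comm _ _)))
      cases (inj₁ 0<σ) (inj₁ 0<τ) = strict (sign (orient (pt r) (pt p) x))
        where
        -- Positive weights put `x` strictly to the left of all four sides; its sign at `rp` then
        -- selects one of the two faces or the diagonal.
        pqx = right (pt p) (pt q) 0<τ (≈0⇒≥0 (orient-abb (pt p) (pt q))) pqs
        qrx = right (pt q) (pt r) 0<τ (≈0⇒≥0 (orient-aba (pt q) (pt r))) qrs
        rsx = left (pt r) (pt s) 0<σ rsq (≈0⇒≥0 (orient-abb (pt r) (pt s)))
        spx = left (pt s) (pt p) 0<σ spq (≈0⇒≥0 (orient-aba (pt s) (pt p)))
        strict : Sign (orient (pt r) (pt p) x) → Common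
        strict (pos rpx) = contradiction (pqx , qrx , rpx)
          (no-edge-inside planar (pqr-face Q applies) h∈S x x∈h)
        strict (neg prx) = contradiction
          (rsx , spx , pos-resp (≈-sym (orient-swap (pt r) (pt p) x)) prx)
          (no-edge-inside planar (rsp-face Q applies) h∈S x x∈h)
        -- If `x` is on `pr`, planarity makes it `p` or `r`, and neither is strictly to the left of
        -- all four sides.
        strict (null rpx) = impossible
          (common-endpoint planar (joins-lohi h) joins-pr h∈S pr∈S h≢pr x x∈h
            (segment-sym (within⇒side (rotateᵛ q r p (rotateᵛ p q r pqr)) x
                           (≈0⇒≥0 rpx , inj₁ pqx , inj₁ qrx) rpx)))
          where
          impossible : ∃[ v ] ((v ≡ lo h) ⊎ (v ≡ hi h)) × ((v ≡ p) ⊎ (v ≡ r)) × x ≈ₚ pt v → Common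
          impossible (v , _ , inj₁ refl , x≈p) = contradiction
            (≈-trans (orient-cong (pt p) (pt q) x≈p) (orient-aba (pt p) (pt q))) (pos⇒≉0 pqx)
          impossible (v , _ , inj₂ refl , x≈r) = contradiction
            (≈-trans (orient-cong (pt q) (pt r) x≈r) (orient-abb (pt q) (pt r))) (pos⇒≉0 qrx)

    crossing : ∀ e e′ → e ≢ e′ → ∀ x → x On e → x On e′ →
               (e ∈ S × e ≢ pr) ⊎ e ≡ qs → (e′ ∈ S × e′ ≢ pr) ⊎ e′ ≡ qs →
               ∃[ v ] v EndpointOf e × v EndpointOf e′ × x ≈ₚ pt v
    crossing e e′ e≢e′ x x∈e x∈e′ (inj₁ (e∈S , _)) (inj₁ (e′∈S , _)) =
      noCrossing e∈S e′∈S e≢e′ x x∈e x∈e′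
    crossing e e′ e≢e′ x x∈e x∈e′ (inj₁ (e∈S , e≢pr)) (inj₂ refl) =
      new e e∈S e≢pr x x∈e (on⇒ qs x joins-qs x∈e′)
    crossing e e′ e≢e′ x x∈e x∈e′ (inj₂ refl) (inj₁ (e′∈S , e′≢pr)) =
      let v , v∈e′ , v∈qs , x≈v = new e′ e′∈S e′≢pr x x∈e′ (on⇒ qs x joins-qs x∈e)
      in v , v∈qs , v∈e′ , x≈v
    crossing e e′ e≢e′ x x∈e x∈e′ (inj₂ refl) (inj₂ refl) = contradiction refl e≢e′

  replace : Quad → EdgeSet → EdgeSet
  replace Q S e with e ≟ᵉ Quad.qs Q | e ≟ᵉ Quad.pr Q
  ... | yes _ | _     = true
  ... | no _  | yes _ = false
  ... | no _  | no _  = S e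

  replace-replaced : ∀ Q S → Replaced Q S (replace Q S)
  replace-replaced Q S e with e ≟ᵉ Quad.qs Q | e ≟ᵉ Quad.pr Q
  ... | yes e≡qs | _        = mk⇔ (λ _ → inj₂ e≡qs) (λ _ → refl)
  ... | no e≢qs  | yes e≡pr = mk⇔ (λ ()) λ
    { (inj₁ (_ , e≢pr)) → contradiction e≡pr e≢pr ; (inj₂ e≡qs) → contradiction e≡qs e≢qs }
  ... | no e≢qs  | no e≢pr  = mk⇔ (λ e∈S → inj₁ (e∈S , e≢pr)) λ
    { (inj₁ (e∈S , _)) → e∈S ; (inj₂ e≡qs) → contradiction e≡qs e≢qs }

  -- Maximality: undoing the flip in a planar superset of the new triangulation
  -- gives a planar superset of the old one.
  performQuad : ∀ T Q → Applies Q (edges T) → ∃[ T′ ] Replaced Q (edges T) (edges T′)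
  performQuad T Q applies@(pr∈T , sides) = record
    { edges   = replace Q (edges T)
    ; planar  = replaced-planar Q (planar T) applies replaced
    ; maximal = λ S planarS ⊆S e e∈S → maximal′ S planarS ⊆S e e∈S (e ≟ᵉ qs)
    } , replaced
    where
    open Quad Q
    replaced : Replaced Q (edges T) (replace Q (edges T))
    replaced = replace-replaced Q (edges T)
    qs∈ : qs ∈ replace Q (edges T)
    qs∈ = Equivalence.from (replaced qs) (inj₂ refl)
    maximal′ : ∀ S → Planar S → replace Q (edges T) ⊆ S → ∀ e → e ∈ S → Dec (e ≡ qs) →
               e ∈ replace Q (edges T)
    maximal′ S planarS ⊆S e e∈S (yes refl) = qs∈
    maximal′ S planarS ⊆S e e∈S (no e≢qs)  = Equivalence.from (replaced e) (inj₁ (e∈T , e≢pr))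
      where
      undone : Replaced (rotate Q) S (replace (rotate Q) S)
      undone = replace-replaced (rotate Q) S
      undone-planar : Planar (replace (rotate Q) S)
      undone-planar = replaced-planar (rotate Q) planarS
        (⊆S qs qs∈ , λ {e} side → ⊆S e (sides-survive Q sides replaced (side-rotate Q side))) undone
      T⊆ : edges T ⊆ replace (rotate Q) S
      T⊆ h h∈T = cases (h ≟ᵉ pr)
        where
        cases : Dec (h ≡ pr) → h ∈ replace (rotate Q) S
        cases (yes h≡pr) = Equivalence.from (undone h) (inj₂ h≡pr)
        cases (no h≢pr)  = Equivalence.from (undone h)
          (inj₁ (⊆S h (Equivalence.from (replaced h) (inj₁ (h∈T , h≢pr))) ,
                 λ { refl → resulting-∉ Q (planar T) pr∈T h∈T }))
      e∈T : e ∈ edges T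
      e∈T = maximal T (replace (rotate Q) S) undone-planar T⊆ e
              (Equivalence.from (undone e) (inj₁ (e∈S , e≢qs)))
      e≢pr : e ≢ pr
      e≢pr refl = resulting-∉ Q planarS e∈S (⊆S qs qs∈)

  quad⇒performs : ∀ {T T′} Q → Applies Q (edges T) → Replaced Q (edges T) (edges T′) →
                  Performs (flip (Quad.pr Q) (Quad.qs Q)) T T′
  quad⇒performs {T} Q applies replaced = record
    { present = proj₁ applies ; p = p ; q = q ; r = r ; s = s
    ; underlying = joins-pr ; resulting = joins-qs
    ; triangle₁ = face⇒triangle T (pqr-face Q applies)
    ; triangle₂ = face⇒triangle T (rsp-face Q applies)
    ; convex = convex ; result = replaced
    }
    where open Quad Q

  module _ {f T T′} (performs : Performs f T T′) where
    private
      open Performs performs renaming (triangle₁ to t; triangle₂ to t′)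
      open Triangle using (side₁; side₂)
      face : Face (edges T) p q r
      face = triangle⇒face {T} t (proj₁ convex)
      face′ : Face (edges T) r s p
      face′ = triangle⇒face {T} t′ (proj₁ (proj₂ (proj₂ convex)))
      corner : ∀ {v} → Corner p q r v → (v ≡ p) ⊎ (v ≡ q) ⊎ (v ≡ r) ⊎ (v ≡ s)
      corner (first  v≡p) = inj₁ v≡p
      corner (second v≡q) = inj₂ (inj₁ v≡q)
      corner (third  v≡r) = inj₂ (inj₂ (inj₁ v≡r))
      corner′ : ∀ {v} → Corner r s p v → (v ≡ p) ⊎ (v ≡ q) ⊎ (v ≡ r) ⊎ (v ≡ s)
      corner′ (first  v≡r) = inj₂ (inj₂ (inj₁ v≡r))
      corner′ (second v≡s) = inj₂ (inj₂ (inj₂ v≡s))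
      corner′ (third  v≡p) = inj₁ v≡p
      cases : ∀ v → 0# ≤ orientᵛ p q v → 0# ≤ orientᵛ q r v → 0# ≤ orientᵛ r s v →
              0# ≤ orientᵛ s p v → (0# < orientᵛ r p v) ⊎ (0# ≤ - orientᵛ r p v) →
              (v ≡ p) ⊎ (v ≡ q) ⊎ (v ≡ r) ⊎ (v ≡ s)
      cases v pqv qrv rsv spv (inj₁ rpv) =
        corner (face-closed (planar T) face v (pqv , qrv , inj₁ rpv))
      cases v pqv qrv rsv spv (inj₂ prv) =
        corner′ (face-closed (planar T) face′ v
          (rsv , spv , nonneg-resp (≈-sym (orient-swap (point r) (point p) (point v))) prv))

    -- For `empty`, a vertex of the closed quadrilateral is assigned to one of the two closed
    -- triangles by its sign at `rp`, and `face-closed` applies there.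
    performed-quad : Quad
    performed-quad = record
      { p = p ; q = q ; r = r ; s = s
      ; pq = proj₁ (side₁ t) ; qr = proj₁ (side₂ t) ; rs = proj₁ (side₁ t′) ; sp = proj₁ (side₂ t′)
      ; pr = ε f ; qs = φ f
      ; joins-pq = proj₁ (proj₂ (side₁ t)) ; joins-qr = proj₁ (proj₂ (side₂ t))
      ; joins-rs = proj₁ (proj₂ (side₁ t′)) ; joins-sp = proj₁ (proj₂ (side₂ t′))
      ; joins-pr = underlying ; joins-qs = resulting
      ; convex = convex
      ; empty = λ v pqv qrv rsv spv → cases v pqv qrv rsv spv (pos-or-nonneg (orientᵛ r p v))
      }

    performed-applies : Applies performed-quad (edges T)
    performed-applies = present , sides
      where
      sides : HasSides performed-quad (edges T)
      sides (inj₁ refl)               = proj₂ (proj₂ (side₁ t))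
      sides (inj₂ (inj₁ refl))        = proj₂ (proj₂ (side₂ t))
      sides (inj₂ (inj₂ (inj₁ refl))) = proj₂ (proj₂ (side₁ t′))
      sides (inj₂ (inj₂ (inj₂ refl))) = proj₂ (proj₂ (side₂ t′))

    performed-replaced : Replaced performed-quad (edges T) (edges T′)
    performed-replaced = result

open import Data.Nat.Base using (_≤_; _<_; _*_)

-- Exchanging neighbouring flips

module FlipSequences {c ℓ₁ ℓ₂} (ℝ : RealNumbers c ℓ₁ ℓ₂) {n} (P : Plane.PointSet ℝ n) where
  open Triangulations ℝ P hiding (begin)
  open PlanarSubdivisions ℝ P
  open Edge
  open Equivalence using (to; from)

  module _ {T T′ : Triangulation} (Q : Quad) (applies : Applies Q (edges T))
           (replaced : Replaced Q (edges T) (edges T′)) where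
    open Quad Q

    flip-∈ : ∀ {e} → e ∈ edges T → e ≢ pr → e ∈ edges T′
    flip-∈ e∈T e≢pr = from (replaced _) (inj₁ (e∈T , e≢pr))

    flip-∈⁻ : ∀ {e} → e ∈ edges T′ → e ≢ qs → e ∈ edges T
    flip-∈⁻ {e} e∈T′ e≢qs with to (replaced e) e∈T′
    ... | inj₁ (e∈T , _) = e∈T
    ... | inj₂ e≡qs      = contradiction e≡qs e≢qs

    removed-∉ : pr ∉ edges T′
    removed-∉ pr∈T′ with to (replaced pr) pr∈T′
    ... | inj₁ (_ , pr≢pr) = pr≢pr refl
    ... | inj₂ pr≡qs       = diagonals-differ convex joins-pr joins-qs pr≡qs

    inserted-∈ : qs ∈ edges T′
    inserted-∈ = from (replaced qs) (inj₂ refl)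

    present⇒≢qs : ∀ {e} → e ∈ edges T → e ≢ qs
    present⇒≢qs e∈T refl = resulting-∉ Q (planar T) (proj₁ applies) e∈T

    inverse-applies : Applies (rotate Q) (edges T′)
    inverse-applies =
      inserted-∈ , λ side → sides-survive Q (proj₂ applies) replaced (side-rotate Q side)

    -- The inserted edge is the diagonal that the inverse flip `rotate Q` removes.
    face-at-inserted : ∀ {a b d e} → Face (edges T′) a b d → SideOf qs a b d → SideOf e a b d →
                       e ≢ qs → Side Q e
    face-at-inserted f qs-side e-side e≢qs =
      side-rotate Q (face-at-diagonal (rotate Q) (planar T′) inverse-applies f qs-side e-side e≢qs)

    sides-share-inserted : ∀ {e} → Side Q e → SharesFace (edges T′) e qs
    sides-share-inserted side = side-shares-face (rotate Q) inverse-applies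
      (side-rotate⁻ side) (present⇒≢qs (proj₂ applies side))
      where
      side-rotate⁻ : ∀ {e} → Side Q e → Side (rotate Q) e
      side-rotate⁻ (inj₁ e≡pq)               = inj₂ (inj₂ (inj₂ e≡pq))
      side-rotate⁻ (inj₂ (inj₁ e≡qr))        = inj₁ e≡qr
      side-rotate⁻ (inj₂ (inj₂ (inj₁ e≡rs))) = inj₂ (inj₁ e≡rs)
      side-rotate⁻ (inj₂ (inj₂ (inj₂ e≡sp))) = inj₂ (inj₂ (inj₁ e≡sp))

  -- The flip Q can depend only on flips that insert an edge e with InQuad Q e.
  InQuad : Quad → Edge n → Set
  InQuad Q e = (e ≡ Quad.pr Q) ⊎ Side Q e

  sideOf? : ∀ e a b d → Dec (SideOf e a b d)
  sideOf? e a b d = joins? a b ⊎-dec joins? b d ⊎-dec joins? d a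
    where
    joins? : ∀ a b → Dec (Joins e a b)
    joins? a b = ((lo e Fin.≟ a) ×-dec (hi e Fin.≟ b)) ⊎-dec ((lo e Fin.≟ b) ×-dec (hi e Fin.≟ a))

  -- Only the presence of edges has to be checked. Before `Q`, a side of `Q′` could be missing only
  -- if `Q` inserts it; after `Q′`, an edge of `Q` could be missing only if `Q′` removes it.
  commute : ∀ {T T₁ T₂} (Q Q′ : Quad) → Applies Q (edges T) → Replaced Q (edges T) (edges T₁) →
            Applies Q′ (edges T₁) → Replaced Q′ (edges T₁) (edges T₂) →
            Quad.pr Q′ ∈ edges T → ¬ Side Q′ (Quad.qs Q) →
            ∃[ U ] Applies Q′ (edges T) × Replaced Q′ (edges T) (edges U) ×
                   Applies Q (edges U) × Replaced Q (edges U) (edges T₂)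
  commute {T} {T₁} {T₂} Q Q′ applies replaced applies′ replaced′ e∈T independent =
    U , appliesT , replacedU , appliesU , λ e → mk⇔ (⇒ e) (⇐ e)
    where
    module Q = Quad Q
    module Q′ = Quad Q′
    appliesT : Applies Q′ (edges T)
    appliesT = e∈T , λ side →
      flip-∈⁻ {T} {T₁} Q applies replaced (proj₂ applies′ side) λ { refl → independent side }
    performed = performQuad T Q′ appliesT
    U = proj₁ performed
    replacedU = proj₂ performed
    pr≢ : Q.pr ≢ Q′.pr
    pr≢ eq = removed-∉ {T} {T₁} Q applies replaced (subst (_∈ edges T₁) (sym eq) (proj₁ applies′))
    -- A side of `Q` shares a face of `T₁` with the edge inserted by `Q`. If `Q′` removed that side,
    -- the inserted edge would be a side of `Q′`.
    sides : ∀ {h} → Side Q h → h ≢ Q′.pr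
    sides side refl =
      let _ , _ , _ , _ , f , pr-side , qs-side =
            sides-share-inserted {T} {T₁} Q applies replaced side
      in independent (face-at-diagonal Q′ (planar T₁) applies′ f pr-side qs-side
                       (present⇒≢qs {T} {T₁} Q applies replaced e∈T ∘ sym))
    appliesU : Applies Q (edges U)
    appliesU = flip-∈ {T} {U} Q′ appliesT replacedU (proj₁ applies) pr≢ ,
               λ side → flip-∈ {T} {U} Q′ appliesT replacedU (proj₂ applies side) (sides side)
    ⇒ : ∀ e → e ∈ edges T₂ → (e ∈ edges U × e ≢ Q.pr) ⊎ e ≡ Q.qs
    ⇒ e e∈ with to (replaced′ e) e∈
    ... | inj₂ refl = inj₁ (from (replacedU e) (inj₂ refl) ,
      λ eq → present⇒≢qs {T} {U} Q′ appliesT replacedU (proj₁ applies) (sym eq))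
    ... | inj₁ (e∈T₁ , e≢) with to (replaced e) e∈T₁
    ...   | inj₂ e≡           = inj₂ e≡
    ...   | inj₁ (e∈T , e≢pr) = inj₁ (from (replacedU e) (inj₁ (e∈T , e≢)) , e≢pr)
    ⇐ : ∀ e → (e ∈ edges U × e ≢ Q.pr) ⊎ e ≡ Q.qs → e ∈ edges T₂
    ⇐ e (inj₂ refl) = from (replaced′ e) (inj₁ (from (replaced e) (inj₂ refl) ,
      present⇒≢qs {T} {T₁} Q applies replaced e∈T ∘ sym))
    ⇐ e (inj₁ (e∈U , e≢pr)) with to (replacedU e) e∈U
    ... | inj₂ e≡         = from (replaced′ e) (inj₂ e≡)
    ... | inj₁ (e∈T , e≢) = from (replaced′ e) (inj₁ (from (replaced e) (inj₁ (e∈T , e≢pr)) , e≢))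

  -- A single decision of the walk

  module Walks (Tend : Triangulation) {r : ℕ} (quad : Fin r → Quad) where

    removes inserts : Fin r → Edge n
    removes i = Quad.pr (quad i)
    inserts i = Quad.qs (quad i)

    -- Flips keep their original index, and with it their quadrilateral, in every reordering, so the
    -- nodes of the digraph remain recognisable.
    data Path : Triangulation → List (Fin r) → Set (c ⊔ ℓ₁ ⊔ ℓ₂) where
      done : ∀ {T} → T ≐ Tend → Path T []
      step : ∀ {T T′ i is} → Applies (quad i) (edges T) → Replaced (quad i) (edges T) (edges T′) →
             Path T′ is → Path T (i ∷ is)

    -- The edges of the walk are removed by the remaining flips, for the first time
    -- in the order in which the walk lists them.
    data Pending : List (Edge n) → List (Fin r) → Set where
      []   : ∀ {is} → Pending [] is
      here : ∀ {e W i is} → removes i ≡ e → All (e ≢_) W → Pending W is → Pending (e ∷ W) (i ∷ is)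
      skip : ∀ {W i is} → All (removes i ≢_) W → Pending W is → Pending W (i ∷ is)

    -- The number of remaining flips before the first that removes the current edge. A move lowers
    -- it, so each walk ends.
    depth : ∀ {W is} → Pending W is → ℕ
    depth []           = 0
    depth (here _ _ _) = 0
    depth (skip _ w)   = ℕ.suc (depth w)

    -- The flip of `e` can be brought to the front; `independent` records that it depends on none of
    -- the flips it overtakes.
    record Ready (T : Triangulation) (e : Edge n) (W : List (Edge n)) (is : List (Fin r)) :
                 Set (c ⊔ ℓ₁ ⊔ ℓ₂) where
      field
        next         : Fin r
        before after : List (Fin r)
        split        : is ≡ before ++ next ∷ after
        current      : removes next ≡ e
        applies      : Applies (quad next) (edges T)
        {T′}         : Triangulation
        replaced     : Replaced (quad next) (edges T) (edges T′)
        path         : Path T′ (before ++ after)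
        pending      : Pending W (before ++ after)
        fresh        : All (e ≢_) W
        independent  : All (λ i → ¬ InQuad (quad next) (inserts i)) before

    record Detour (T : Triangulation) (e : Edge n) (W : List (Edge n)) (is : List (Fin r))
                  (bound : ℕ) : Set (c ⊔ ℓ₁ ⊔ ℓ₂) where
      field
        {e′}    : Edge n
        e′∈T    : e′ ∈ edges T
        shares  : SharesFace (edges T) e e′
        pending : Pending (e′ ∷ e ∷ W) is
        shorter : depth pending < bound

    -- The answer for `T′` is pulled back through flip `i`. If the edge inserted by `i` lies on the
    -- shared face or on the quadrilateral found later, `i` itself changes a triangle at `e` and the
    -- detour goes to the edge it removes. Otherwise the face is already present in `T`, or the flip
    -- of `e` commutes with `i`.
    advance : ∀ {T e W is} → Path T is → e ∈ edges T → (w : Pending (e ∷ W) is) →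
              Ready T e W is ⊎ Detour T e W is (depth w)
    advance (step {i = i} {is = is} applies replaced path) e∈T (here refl fresh w) = inj₁ record
      { next = i ; before = [] ; after = is ; split = refl ; current = refl
      ; applies = applies ; replaced = replaced ; path = path
      ; pending = w ; fresh = fresh ; independent = []
      }
    advance {T} {e} {W} (step {T′ = T′} {i} {is} applies replaced path) e∈T (skip (i≢e ∷ i≢W) w) =
      cases (advance path (flip-∈ {T} {T′} Q applies replaced e∈T (≢-sym i≢e)) w)
      where
      Q = quad i
      e≢inserted : e ≢ inserts i
      e≢inserted = present⇒≢qs {T} {T′} Q applies replaced e∈T
      -- Sharing a face with the inserted edge makes `e` a side of the quadrilateral of `i`; in `T`
      -- it then shares a face with the other diagonal.
      touching : ∀ {a b d} → Face (edges T′) a b d → SideOf e a b d → SideOf (inserts i) a b d →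
                 Detour T e W (i ∷ is) (ℕ.suc (depth w))
      touching f e-side qs-side = record
        { e′∈T    = proj₁ applies
        ; shares  = side-shares-face Q applies
            (face-at-inserted {T} {T′} Q applies replaced f qs-side e-side e≢inserted) (≢-sym i≢e)
        ; pending = here refl (i≢e ∷ i≢W) w
        ; shorter = s≤s z≤n
        }
      detour : Detour T′ e W is (depth w) → Detour T e W (i ∷ is) (ℕ.suc (depth w))
      detour record { e′ = e′ ; e′∈T = e′∈T′ ; shares = e≢e′ , a , b , d , f , e-side , e′-side
                    ; pending = w′ ; shorter = shorter }
        with sideOf? (inserts i) a b d
      ... | yes qs-side  = touching f e-side qs-side
      ... | no ¬qs-side = record
        { e′      = e′
        ; e′∈T    = keep e′-side e′∈T′
        ; shares  = e≢e′ , a , b , d , face-⊆ f keep , e-side , e′-side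
        ; pending = skip ((λ { refl → removed-∉ {T} {T′} Q applies replaced e′∈T′ }) ∷ i≢e ∷ i≢W) w′
        ; shorter = s≤s shorter
        }
        where
        keep : ∀ {h} → SideOf h a b d → h ∈ edges T′ → h ∈ edges T
        keep h-side h∈T′ = flip-∈⁻ {T} {T′} Q applies replaced h∈T′ λ { refl → ¬qs-side h-side }
      ready : Ready T′ e W is → Ready T e W (i ∷ is) ⊎ Detour T e W (i ∷ is) (ℕ.suc (depth w))
      ready record { next = g ; before = before ; after = after ; split = split ; current = refl
                   ; applies = appliesᵍ ; T′ = T₂ ; replaced = replacedᵍ ; path = path
                   ; pending = pending ; fresh = fresh ; independent = independent }
        with side? (quad g) (inserts i)
      ... | yes side =
        let _ , _ , _ , _ , f , qs-side , e-side =
              side-shares-face (quad g) appliesᵍ side (≢-sym e≢inserted)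
        in inj₂ (touching f e-side qs-side)
      ... | no ¬side =
        let U , appliesT , replacedU , appliesU , replacedT₂ =
              commute {T} {T′} {T₂} Q (quad g) applies replaced appliesᵍ replacedᵍ e∈T ¬side
        in inj₁ record
        { next = g ; before = i ∷ before ; after = after
        ; split = cong (i ∷_) split ; current = refl
        ; applies = appliesT ; T′ = U ; replaced = replacedU ; path = step appliesU replacedT₂ path
        ; pending = skip i≢W pending ; fresh = fresh
        ; independent = Sum.[ ≢-sym e≢inserted , ¬side ] ∷ independent
        }
      cases : Ready T′ e W is ⊎ Detour T′ e W is (depth w) →
              Ready T e W (i ∷ is) ⊎ Detour T e W (i ∷ is) (ℕ.suc (depth w))
      cases (inj₁ now)   = ready now
      cases (inj₂ later) = inj₂ (detour later)

    necessary-pending : ∀ {T e is} → Path T is → Necessary Tend T e → Pending (e ∷ []) is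
    necessary-pending (done T≐) (e∈T , e∉Tend) = contradiction (trans (sym (T≐ _)) e∈T) e∉Tend
    necessary-pending {T} {e} (step {T′ = T′} {i} applies replaced path) (e∈T , e∉Tend)
      with removes i ≟ᵉ e
    ... | yes i≡e = here i≡e [] []
    ... | no i≢e  = skip (i≢e ∷ [])
      (necessary-pending path (flip-∈ {T} {T′} (quad i) applies replaced e∈T (≢-sym i≢e) , e∉Tend))

    -- A finite search over pairs of endpoints; deciding `l < h` supplies the order proof that an
    -- edge stores irrelevantly.
    necessary? : ∀ T → Dec (∃[ e ] Necessary Tend T e)
    necessary? T = map′ (λ (_ , _ , e , _ , _ , necessary) → e , necessary)
                        (λ (e , necessary) → lo e , hi e , e , refl , refl , necessary)
                        (Fin.any? λ l → Fin.any? λ h → between l h)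
      where
      between : ∀ l h → Dec (∃[ e ] lo e ≡ l × hi e ≡ h × Necessary Tend T e)
      between l h with l Fin.<? h
      ... | no l≮h  = no λ { (edge _ _ l<h , refl , refl , _) → Irrelevant.⊥-elim (l≮h l<h) }
      ... | yes l<h = map′ (λ necessary → edge l h l<h , refl , refl , necessary)
                           (λ { (_ , refl , refl , necessary) → necessary })
                           ((edges T (edge l h l<h) Bool.≟ true) ×-dec
                            ¬? (edges Tend (edge l h l<h) Bool.≟ true))

    -- Otherwise `T` would be contained in the planar `Tend`, and maximality of `T` would make them
    -- equal.
    necessary-exists : ∀ T → ¬ (T ≐ Tend) → ∃[ e ] Necessary Tend T e
    necessary-exists T T≭Tend with necessary? T
    ... | yes necessary = necessary
    ... | no ¬necessary = contradiction (λ e → equal e (⊆Tend e) (Tend⊆ e)) T≭Tend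
      where
      ⊆Tend : edges T ⊆ edges Tend
      ⊆Tend e e∈T with edges Tend e Bool.≟ true
      ... | yes e∈Tend = e∈Tend
      ... | no e∉Tend  = contradiction (e , e∈T , e∉Tend) ¬necessary
      Tend⊆ : edges Tend ⊆ edges T
      Tend⊆ = maximal T (edges Tend) (planar Tend) ⊆Tend
      equal : ∀ e → (e ∈ edges T → e ∈ edges Tend) → (e ∈ edges Tend → e ∈ edges T) →
              edges T e ≡ edges Tend e
      equal e ⇒ ⇐ with edges T e | edges Tend e
      ... | true  | true  = refl
      ... | false | false = refl
      ... | true  | false = sym (⇒ refl)
      ... | false | true  = ⇐ refl

    -- Reordering the flips and running the whole process

    flips : List (Fin r) → List Flip
    flips = map λ i → flip (removes i) (inserts i)

    AllPairs-split : ∀ {ℓ} {R : Fin r → Fin r → Set ℓ} g before {after} →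
      AllPairs R (before ++ g ∷ after) →
      AllPairs R (before ++ after) × All (λ i → R i g) before × All (R g) after
    AllPairs-split g []           (gs ∷ pairs) = pairs , [] , gs
    AllPairs-split g (i ∷ before) (is ∷ pairs)
      with AllPairs-split g before pairs | All.++⁻ before is
    ... | pairs′ , to-g , from-g | is-before , i-g ∷ is-after =
      All.++⁺ is-before is-after ∷ pairs′ , i-g ∷ to-g , from-g

    -- Dependent i j: flip i has to precede flip j.
    module Execution {ℓ} (Dependent : Fin r → Fin r → Set ℓ)
      (dependent⇒inQuad : ∀ {i j} → Dependent i j → InQuad (quad j) (inserts i))
      (Reached : ℕ → Triangulation → Set (c ⊔ ℓ₁ ⊔ ℓ₂))
      (extend : ∀ {k f T T′} → Reached k T → Performs f T T′ → Reached (ℕ.suc k) T′)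
      (not-early : ∀ {k T} → Reached k T → T ≐ Tend → r ≤ k) where

      -- The condition for `i` to stand before `j`. Distinctness is included so that a pairwise
      -- compatible list has no repetitions.
      Compatible : Fin r → Fin r → Set ℓ
      Compatible i j = i ≢ j × ¬ Dependent j i

      record Execution (T : Triangulation) (W : List (Edge n)) (is : List (Fin r)) :
                       Set (c ⊔ ℓ₁ ⊔ ℓ₂ ⊔ ℓ) where
        constructor execution
        field
          {actions} : List Action
          {order}   : List (Fin r)
          run       : Run Tend T W actions (flips order)
          -- A move trades one action to come for one more edge on the walk; a flip uses up one
          -- action and one edge, the two units allotted to it.
          bound     : length actions ℕ.+ length W ≤ 2 * length is
          permuted  : order ↭ is
          ordered   : AllPairs Compatible order

      record State (k m : ℕ) (T : Triangulation) (is : List (Fin r)) : Set (c ⊔ ℓ₁ ⊔ ℓ₂ ⊔ ℓ) where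
        constructor state
        field
          path    : Path T is
          ordered : AllPairs Compatible is
          reached : Reached k T
          size    : length is ≡ m
          total   : k ℕ.+ m ≡ r

      -- The mutual recursion descends lexicographically: the number of remaining flips drops with
      -- each flip, and `b`, a bound on the depth of the current edge, with each move. In
      -- `execute-∷` the remaining number is `suc m`, as the current edge is still to be flipped.
      execute-[] : ∀ {T} k m {is} → State k m T is → Execution T [] is
      execute-∷  : ∀ {T e W} k m b {is} → State k (ℕ.suc m) T is → All (_∈ edges T) (e ∷ W) →
                   (w : Pending (e ∷ W) is) → depth w < b → Execution T (e ∷ W) is
      execute-next : ∀ {T} W k m {is} → State k m T is → All (_∈ edges T) W → Pending W is →
                     Execution T W is

      execute-[] k ℕ.zero {[]} (state (done T≐Tend) _ _ _ _) =
        execution (finish T≐Tend) z≤n ↭-refl []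
      execute-[] {T} k (ℕ.suc m) s@(state path _ reached size total) =
        start (execute-∷ k m _ s (proj₁ necessary ∷ []) w ℕ.≤-refl)
        where
        -- Had `Tend` been reached after `k` flips, minimality would give `r ≤ k`, although `suc m`
        -- flips remain.
        unfinished : ¬ (T ≐ Tend)
        unfinished T≐Tend = ℕ.<⇒≱ (ℕ.≤-trans (ℕ.m<m+n k (s≤s z≤n)) (ℕ.≤-reflexive total))
                                  (not-early reached T≐Tend)
        e = proj₁ (necessary-exists T unfinished)
        necessary = proj₂ (necessary-exists T unfinished)
        w = necessary-pending path necessary
        start : Execution T (e ∷ []) _ → Execution T [] _
        start (execution run bound permuted ordered) =
          execution (Run.begin unfinished necessary run)
            -- Choosing the initial edge is no action, so the unit for this edge is given away.
            (ℕ.≤-trans (ℕ.+-monoʳ-≤ _ z≤n) bound) permuted ordered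

      execute-∷ {T} {e} {W} k m (ℕ.suc b) {is} s@(state path ordered reached size total)
                (e∈T ∷ W⊆T) w (s≤s w≤b) with advance path e∈T w
      ... | inj₂ record { e′ = e′ ; e′∈T = e′∈T ; shares = shares
                        ; pending = w′ ; shorter = shorter } =
        walk (execute-∷ k m b s (e′∈T ∷ e∈T ∷ W⊆T) w′ (ℕ.≤-trans shorter w≤b))
        where
        walk : Execution T (e′ ∷ e ∷ W) is → Execution T (e ∷ W) is
        walk (execution {actions} run bound permuted ordered) =
          execution (moving (share⇐ T shares) run)
            (ℕ.≤-trans (ℕ.≤-reflexive (sym (ℕ.+-suc (length actions) _))) bound) permuted ordered
      ... | inj₁ record { next = g ; before = before ; after = after ; split = refl ; current = refl
                        ; applies = applies ; T′ = T′ ; replaced = replaced ; path = path′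
                        ; pending = pending ; fresh = fresh ; independent = independent } =
        back (execute-next W (ℕ.suc k) m
          (state path′ (proj₁ pairs) (extend reached performs) size′
                 (trans (sym (ℕ.+-suc k m)) total))
          W⊆T′ pending)
        where
        Q = quad g
        performs : Performs (flip (removes g) (inserts g)) T T′
        performs = quad⇒performs {T} {T′} Q applies replaced
        pairs = AllPairs-split g before ordered
        perm : g ∷ before ++ after ↭ is
        perm = ↭-sym (shift g before after)
        size′ : length (before ++ after) ≡ m
        size′ = ℕ.suc-injective (trans (↭-length perm) size)
        W⊆T′ : All (_∈ edges T′) W
        W⊆T′ = All.zipWith (λ (h∈T , e≢h) → flip-∈ {T} {T′} Q applies replaced h∈T (≢-sym e≢h))
                           (W⊆T , fresh)
        -- The overtaken flips insert no edge of the quadrilateral of `g`, so none of them has to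
        -- precede it; with the flips in `after` the order is unchanged.
        compatible : All (Compatible g) (before ++ after)
        compatible = All.++⁺
          (All.zipWith (λ ((i≢g , _) , ¬inQuad) → ≢-sym i≢g , ¬inQuad ∘ dependent⇒inQuad)
                       (proj₁ (proj₂ pairs) , independent))
          (proj₂ (proj₂ pairs))
        back : Execution T′ W (before ++ after) → Execution T (e ∷ W) is
        back (execution {actions} run bound permuted ordered) =
          execution (flipping performs W⊆T′ run) bound′ (↭-trans (prep g permuted) perm)
            (All-resp-↭ (↭-sym permuted) compatible ∷ ordered)
          where
          open ℕ.≤-Reasoning
          bound′ : ℕ.suc (length actions ℕ.+ ℕ.suc (length W)) ≤ 2 * length is
          bound′ = begin
            ℕ.suc (length actions ℕ.+ ℕ.suc (length W))
              ≡⟨ cong ℕ.suc (ℕ.+-suc (length actions) _) ⟩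
            2 ℕ.+ (length actions ℕ.+ length W)          ≤⟨ ℕ.+-monoʳ-≤ 2 bound ⟩
            2 ℕ.+ 2 * length (before ++ after)           ≡⟨ ℕ.*-suc 2 _ ⟨
            2 * length (g ∷ before ++ after)             ≡⟨ cong (2 *_) (↭-length perm) ⟩
            2 * length is                                ∎

      execute-next []      k m         s W⊆T w = execute-[] k m s
      execute-next (e ∷ W) k (ℕ.suc m) s W⊆T w = execute-∷ k m _ s W⊆T w ℕ.≤-refl
      execute-next (e ∷ W) k ℕ.zero {[]}    s                  W⊆T ()
      execute-next (e ∷ W) k ℕ.zero {_ ∷ _} (state _ _ _ () _) W⊆T w

-- From an ordered list of nodes to a topological sorting

module _ {ℓ} {A : Set} (G : Digraph ℓ) (label : Fin (∣V∣ G) → A) where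
  private
    V = Fin (∣V∣ G)

    at : (xs : List V) → Fin (length (map label xs)) → V
    at (x ∷ xs) zero    = x
    at (x ∷ xs) (suc k) = at xs k

    lookup-at : ∀ xs k → lookup (map label xs) k ≡ label (at xs k)
    lookup-at (x ∷ xs) zero    = refl
    lookup-at (x ∷ xs) (suc k) = lookup-at xs k

    place : ∀ {x xs} → x ∈ˡ xs → Fin (length (map label xs))
    place (here _)  = zero
    place (there p) = suc (place p)

    at-place : ∀ {x xs} (p : x ∈ˡ xs) → at xs (place p) ≡ x
    at-place (here refl) = refl
    at-place (there p)   = at-place p

    All-at : ∀ {p} {P : V → Set p} {xs} → All P xs → ∀ k → P (at xs k)
    All-at (px ∷ pxs) zero    = px
    All-at (px ∷ pxs) (suc k) = All-at pxs k

    AllPairs-at : ∀ {p} {R : V → V → Set p} {xs} → AllPairs R xs → ∀ {k l} → k Fin.< l →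
                  R (at xs k) (at xs l)
    AllPairs-at (px ∷ pxs) {zero}  {suc l} _         = All-at px l
    AllPairs-at (px ∷ pxs) {suc k} {suc l} (s≤s k<l) = AllPairs-at pxs k<l

  -- Positions are read off the membership proofs; pairwise distinctness makes `at` injective and
  -- hence their inverse. An arc between equal positions would be a loop, and a backward arc
  -- contradicts `pairs`.
  topologicalSorting : ∀ xs → (∀ i → i ∈ˡ xs) → (∀ i → ¬ Arc G i i) →
                       AllPairs (λ i j → i ≢ j × ¬ Arc G j i) xs →
                       IsTopologicalSorting G label (map label xs)
  topologicalSorting xs complete acyclic pairs = record
    { position = mk↔ₛ′ position (at xs) (λ k → injective (at-place (complete (at xs k))))
                       (λ i → at-place (complete i))
    ; labelled = λ i → trans (lookup-at xs (position i)) (cong label (at-place (complete i)))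
    ; forward  = forward
    }
    where
    position : V → Fin (length (map label xs))
    position i = place (complete i)
    injective : ∀ {k l} → at xs k ≡ at xs l → k ≡ l
    injective {k} {l} eq with Fin.<-cmp k l
    ... | tri< k<l _ _ = contradiction eq (proj₁ (AllPairs-at pairs k<l))
    ... | tri≈ _ k≡l _ = k≡l
    ... | tri> _ _ l<k = contradiction (sym eq) (proj₁ (AllPairs-at pairs l<k))
    forward : ∀ {i j} → Arc G i j → position i Fin.< position j
    forward {i} {j} i→j with Fin.<-cmp (position i) (position j)
    ... | tri< i<j _ _ = i<j
    ... | tri≈ _ i≡j _ = contradiction
      (subst (Arc G i) (trans (sym (at-place (complete j)))
        (trans (cong (at xs) (sym i≡j)) (at-place (complete i)))) i→j) (acyclic i)
    ... | tri> _ _ j<i = contradiction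
      (subst₂ (Arc G) (sym (at-place (complete i))) (sym (at-place (complete j))) i→j)
      (proj₂ (AllPairs-at pairs j<i))

-- The shortest sequence as the initial state

module Proof {c ℓ₁ ℓ₂} (ℝ : RealNumbers c ℓ₁ ℓ₂) {n} (P : Plane.PointSet ℝ n) where
  open Triangulations ℝ P
  open PlanarSubdivisions ℝ P
  open FlipSequences ℝ P
  open Equivalence using (to; from)

  applies-resp : ∀ {T T′} Q → T ≐ T′ → Applies Q (edges T) → Applies Q (edges T′)
  applies-resp Q T≐T′ (pr∈ , sides) =
    trans (sym (T≐T′ _)) pr∈ , λ side → trans (sym (T≐T′ _)) (sides side)

  replaced-respˡ : ∀ {T T′ S} Q → T ≐ T′ → Replaced Q (edges T) S → Replaced Q (edges T′) S
  replaced-respˡ Q T≐T′ replaced e = mk⇔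
    (Sum.map₁ (λ (e∈ , e≢) → trans (sym (T≐T′ e)) e∈ , e≢) ∘ to (replaced e))
    (from (replaced e) ∘ Sum.map₁ (λ (e∈ , e≢) → trans (T≐T′ e) e∈ , e≢))

  performs-respʳ : ∀ {f T T′ T″} → T′ ≐ T″ → Performs f T T′ → Performs f T T″
  performs-respʳ T′≐T″ performs = record
    { Performs performs
    ; result = λ e → mk⇔ (λ e∈ → to (result e) (trans (T′≐T″ e) e∈))
                         (λ e∈ → trans (sym (T′≐T″ e)) (from (result e) e∈))
    }
    where open Performs performs using (result)

  valid-∷ : ∀ {m f T T′ Tend} {G : Vector Flip m} → Performs f T T′ → Valid G T′ Tend →
            Valid (f Vector.∷ G) T Tend
  valid-∷ {m} {f} {T} {G = G} performs valid = record
    { stage    = stage′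
    ; starts   = λ _ → refl
    ; ends     = ends
    ; performs = performs′
    }
    where
    open Valid valid renaming (performs to performsᵛ)
    stage′ : Fin (ℕ.suc (ℕ.suc m)) → Triangulation
    stage′ zero    = T
    stage′ (suc i) = stage i
    performs′ : ∀ i → Performs ((f Vector.∷ G) i) (stage′ (inject₁ i)) (stage′ (suc i))
    -- The first stage of `valid` agrees with `T′` only up to `≐`, so the result of the flip is
    -- transported.
    performs′ zero    = performs-respʳ (λ e → sym (starts e)) performs
    performs′ (suc i) = performsᵛ i

  valid-[] : ∀ {T Tend} → T ≐ Tend → Valid {0} (λ ()) T Tend
  valid-[] {T} T≐Tend = record
    { stage = λ _ → T ; starts = λ _ → refl ; ends = T≐Tend ; performs = λ () }

  module _ (Tstart Tend : Triangulation) {r} (F : Vector Flip r)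
           (shortest : IsShortest F Tstart Tend) where
    private
      valid = proj₁ shortest
      open Valid valid

      quad : Fin r → Quad
      quad i = performed-quad (performs i)

      applies : ∀ i → Applies (quad i) (edges (stage (inject₁ i)))
      applies i = performed-applies (performs i)

      open Walks Tend quad

      -- Generalised over `index` and `T`, which the recursion shifts; `T₀` allows the start to
      -- agree with the first stage only up to `≐`.
      path-from : ∀ m (index : Fin m → Fin r) (T : Fin (ℕ.suc m) → Triangulation) →
        (∀ i → Applies (quad (index i)) (edges (T (inject₁ i))) ×
               Replaced (quad (index i)) (edges (T (inject₁ i))) (edges (T (suc i)))) →
        T (fromℕ m) ≐ Tend → ∀ T₀ → T zero ≐ T₀ → Path T₀ (tabulate index)
      path-from ℕ.zero    index T flips end T₀ start =
        done λ e → trans (sym (start e)) (end e)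
      path-from (ℕ.suc m) index T flips end T₀ start = step
        (applies-resp {T zero} {T₀} (quad (index zero)) start (proj₁ (flips zero)))
        (replaced-respˡ {T zero} {T₀} (quad (index zero)) start (proj₂ (flips zero)))
        (path-from m (index ∘ suc) (T ∘ suc) (flips ∘ suc) end (T (suc zero)) λ _ → refl)

      -- In the stage to which the arc refers, the shared triangle is a face at the diagonal of flip
      -- `j`, so `face-at-diagonal` applies.
      arc⇒inQuad : ∀ {i j} → Arc (D F valid) i j → InQuad (quad j) (inserts i)
      arc⇒inQuad (_ , inj₁ φ≡ε , _) = inj₁ φ≡ε
      arc⇒inQuad {i} {j} (_ , inj₂ shares , _) =
        let φ≢ε , _ , _ , _ , f , φ-side , ε-side = share⇒ {stage (inject₁ j)} shares
        in inj₂ (face-at-diagonal (quad j) (planar (stage (inject₁ j))) (applies j)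
                                  f ε-side φ-side φ≢ε)

      -- Minimality of `F` as seen after `k` flips: every valid continuation from `T` needs at least
      -- the missing ones. Prepending the performed flip to a continuation preserves this.
      Reached : ℕ → Triangulation → Set _
      Reached k T = ∀ {m} (G : Vector Flip m) → Valid G T Tend → r ≤ k ℕ.+ m

      open Execution (Arc (D F valid)) arc⇒inQuad Reached
        (λ {k} reached performs G valid → ℕ.≤-trans (reached _ (valid-∷ performs valid))
                                            (ℕ.≤-reflexive (ℕ.+-suc k _)))
        (λ {k} reached T≐Tend → ℕ.≤-trans (reached _ (valid-[] T≐Tend))
                                  (ℕ.≤-reflexive (ℕ.+-identityʳ k)))

      initial : State 0 r Tstart (allFin r)
      initial = record
        { path    = path-from r (λ i → i) stage (λ i → applies i , performed-replaced (performs i))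
                      ends Tstart starts
        -- In the original order every arc increases the index.
        ; ordered = AllPairs.tabulate⁺-< λ i<j → Fin.<⇒≢ i<j , λ (j<i , _) → Fin.<-asym i<j j<i
        ; reached = λ G → proj₂ shortest G
        ; size    = length-tabulate _
        ; total   = refl
        }

    topological-run : ∃[ actions ] ∃[ F′ ]
      Run Tend Tstart [] actions F′ × (length actions ≤ 2 * r) × (length F′ ≡ r) ×
      IsTopologicalSorting (D F valid) F F′
    topological-run with execute-[] 0 r initial
    ... | execution {actions} {order} run bound permuted ordered =
      actions , map F order , run ,
      ℕ.≤-trans (ℕ.≤-reflexive (sym (ℕ.+-identityʳ _)))
        (ℕ.≤-trans bound (ℕ.≤-reflexive (cong (2 *_) (length-tabulate {n = r} _)))) ,
      trans (length-map F order) (trans (↭-length permuted) (length-tabulate {n = r} _)) ,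
      topologicalSorting (D F valid) F order
        (λ i → ∈-resp-↭ (↭-sym permuted) (∈-allFin i))
        (λ i (i<i , _) → Fin.<-irrefl refl i<i) ordered

theorem1 : ∀ {c ℓ₁ ℓ₂} (ℝ : RealNumbers c ℓ₁ ℓ₂) {n : ℕ} (P : Plane.PointSet ℝ n) →
    let open Triangulations ℝ P in
    (Tstart Tend : Triangulation) {r : ℕ} (F : Vector Flip r) →
    (shortest : IsShortest F Tstart Tend) →
    let D_F = D F (proj₁ shortest) in
    ∃[ actions ] ∃[ F′ ]
    Run Tend Tstart [] actions F′ ×
    (length actions ≤ 2 * ∣V∣ D_F) ×
    (length F′ ≡ ∣V∣ D_F) ×
    IsTopologicalSorting D_F F F′
theorem1 ℝ P = Proof.topological-run ℝ P
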